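{- Let $m\ge 1$ be an integer, let $a>0$, and let $F_m$ be a real polynomial of degree $m$ with $F_m(0)=1$ all of whose zeros are real. Let $\alpha_1,\ldots,\alpha_m$ denote the zeros of the polynomial $t\mapsto F_m(-t)$, multiple zeros being repeated according to multiplicity. For an integer $p$ consider the condition $$(\ast_p)\qquad 0\le \alpha_1\le\alpha_2\le\cdots\le\alpha_p\quad\text{and}\quad \big(\{a,a+1,a+2,\ldots\}\cap[a,\alpha_p)\big)\subset\{\alpha_1,\alpha_2,\ldots,\alpha_p\}.$$ (i) If $(\ast_p)$ holds for $p=m$, then all zeros of the polynomial $\hat{w}(a;F_m\,|\,x)$ are real and negative. (ii) If $(\ast_p)$ holds for $p=m-1$ and $\alpha_m$ is any real number, then all zeros of $\hat{w}(a;F_m\,|\,x)$ are real and at most one of them is positive.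
   Context: $(a)_n=a(a+1)\cdots(a+n-1)$, $(a)_0=1$, is the Pochhammer symbol. For real $a$ and a polynomial $F_m$ of degree $m$ with $F_m(0)=1$, the $F_m$-Eulerian polynomial $\hat{w}(x)=\hat{w}(a;F_m\,|\,x)$ is the polynomial in $x$ of degree at most $m$ defined by $$\sum_{n=0}^{\infty}F_m(n)\frac{(a)_n}{n!}x^n=\frac{\hat{w}(a;F_m\,|\,x)}{(1-x)^{m+a}},$$ where $(1-x)^{ -(m+a)}$ is understood as its power series at $0$ (equivalently, as the principal branch for $|x|<1$). For $p=0$ (i.e. $m=1$ in part (ii)) the condition $(\ast_p)$ is vacuous. -}

module Defs where

open import Algebra.Bundles using (CommutativeRing)
open import Algebra.Core using (Op₁)
import Algebra.Definitions.RawMonoid as RawMonoidDefs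
open import Data.Fin.Base as Fin using (Fin; toℕ; fromℕ)
open import Data.List.Base using (List; []; _∷_; map)
open import Data.Nat.Base as ℕ using (ℕ; zero; suc; _∸_; _!)
open import Data.Product.Base using (_×_; ∃; ∃-syntax)
open import Data.Unit.Base using (⊤)
import Data.Vec.Functional as Vector
open import Level using (0ℓ) renaming (suc to lsuc)
open import Relation.Binary.Core using (Rel)
import Relation.Binary.Construct.StrictToNonStrict as StrictToNonStrict
open import Relation.Binary.Structures using (IsStrictTotalOrder)
open import Relation.Nullary.Negation.Core using (¬_)
open import Relation.Unary using (Pred)

-- The classical axioms of ℝ, which determine it up to isomorphism.
record CompleteOrderedField : Set (lsuc 0ℓ) where
  infix  4 _<_
  infix  8 _⁻¹
  field
    commutativeRing : CommutativeRing 0ℓ 0ℓ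

  open CommutativeRing commutativeRing public

  field
    _⁻¹                : Op₁ Carrier
    -- The value of 0# ⁻¹ is left unspecified.
    *-inverseʳ         : ∀ x → x ≉ 0# → x * x ⁻¹ ≈ 1#
    _<_                : Rel Carrier 0ℓ
    isStrictTotalOrder : IsStrictTotalOrder _≈_ _<_
    0<1                : 0# < 1#
    +-monoʳ-<          : ∀ x {y z} → y < z → x + y < x + z
    *-pos              : ∀ {x y} → 0# < x → 0# < y → 0# < x * y

  open StrictToNonStrict _≈_ _<_ public using (_≤_)

  IsUpperBound : Pred Carrier 0ℓ → Carrier → Set
  IsUpperBound P u = ∀ x → P x → x ≤ u

  field
    supremum : (P : Pred Carrier 0ℓ) → ∃ P → ∃ (IsUpperBound P) →
               ∃[ s ] IsUpperBound P s × (∀ u → IsUpperBound P u → s ≤ u)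

module Eulerian (ℝ : CompleteOrderedField) where

  open CompleteOrderedField ℝ
  open RawMonoidDefs +-rawMonoid using (sum) renaming (_×_ to _·_)

  fromNat : ℕ → Carrier
  fromNat n = n · 1#

  -- Polynomials are lists of coefficients, constant term first; trailing
  -- zeros are allowed, so equality is _≈ₚ_.

  Poly : Set
  Poly = List Carrier

  coeff : Poly → ℕ → Carrier
  coeff []      _       = 0#
  coeff (c ∷ p) zero    = c
  coeff (c ∷ p) (suc n) = coeff p n

  infix 4 _≈ₚ_
  _≈ₚ_ : Rel Poly 0ℓ
  p ≈ₚ q = ∀ n → coeff p n ≈ coeff q n

  DegreeAtMost : ℕ → Pred Poly 0ℓ
  DegreeAtMost m p = ∀ n → m ℕ.< n → coeff p n ≈ 0#

  HasDegree : ℕ → Pred Poly 0ℓ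
  HasDegree m p = coeff p m ≉ 0# × DegreeAtMost m p

  infixl 6 _+ₚ_
  _+ₚ_ : Poly → Poly → Poly
  []      +ₚ q       = q
  (c ∷ p) +ₚ []      = c ∷ p
  (c ∷ p) +ₚ (d ∷ q) = (c + d) ∷ (p +ₚ q)

  infixl 7 _*ₚ_
  _*ₚ_ : Poly → Poly → Poly
  []      *ₚ q = []
  (c ∷ p) *ₚ q = map (c *_) q +ₚ (0# ∷ p *ₚ q)

  infix 4 _∣ₚ_
  _∣ₚ_ : Rel Poly 0ℓ
  p ∣ₚ q = ∃[ r ] q ≈ₚ p *ₚ r

  eval : Poly → Carrier → Carrier
  eval []      x = 0#
  eval (c ∷ p) x = c + x * eval p x

  -- F(-t)
  reflect : Poly → Poly
  reflect []      = []
  reflect (c ∷ p) = c ∷ map -_ (reflect p)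

  X-_ : Carrier → Poly
  X- r = - r ∷ 1# ∷ []

  -- α lists all (complex) zeros of p, repeated according to multiplicity;
  -- in particular all of them are real.
  ZerosWithMultiplicity : ∀ {m} → Poly → (Fin m → Carrier) → Set
  ZerosWithMultiplicity p α =
    ∃[ c ] c ≉ 0# ×
           p ≈ₚ (c ∷ []) *ₚ Vector.foldr _*ₚ_ (1# ∷ []) (λ i → X- (α i))

  record ℂ : Set where
    constructor _+i_
    field
      re im : Carrier

  open ℂ public

  ofReal : Carrier → ℂ
  ofReal x = x +i 0#

  _+ᶜ_ : ℂ → ℂ → ℂ
  (a +i b) +ᶜ (c +i d) = (a + c) +i (b + d)

  _*ᶜ_ : ℂ → ℂ → ℂ
  (a +i b) *ᶜ (c +i d) = (a * c - b * d) +i (a * d + b * c)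

  evalᶜ : Poly → ℂ → ℂ
  evalᶜ []      z = ofReal 0#
  evalᶜ (c ∷ p) z = ofReal c +ᶜ (z *ᶜ evalᶜ p z)

  IsZeroOf : Poly → Pred ℂ 0ℓ
  IsZeroOf p z = re (evalᶜ p z) ≈ 0# × im (evalᶜ p z) ≈ 0#

  AllZerosReal : Pred Poly 0ℓ
  AllZerosReal p = ∀ z → IsZeroOf p z → im z ≈ 0#

  AllZerosRealNegative : Pred Poly 0ℓ
  AllZerosRealNegative p = ∀ z → IsZeroOf p z → im z ≈ 0# × re z < 0#

  -- Zeros are counted with multiplicity, so a positive zero must be simple.
  AtMostOnePositiveZero : Pred Poly 0ℓ
  AtMostOnePositiveZero p =
    (∀ r s → 0# < r → 0# < s →
       IsZeroOf p (ofReal r) → IsZeroOf p (ofReal s) → r ≈ s) ×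
    (∀ r → 0# < r → ¬ ((X- r) *ₚ (X- r) ∣ₚ p))

  PowerSeries : Set
  PowerSeries = ℕ → Carrier

  infixl 7 _⋆_
  _⋆_ : PowerSeries → PowerSeries → PowerSeries
  (f ⋆ g) n = sum {suc n} (λ k → f (toℕ k) * g (n ∸ toℕ k))

  pochhammer : Carrier → ℕ → Carrier
  pochhammer a zero    = 1#
  pochhammer a (suc n) = pochhammer a n * (a + fromNat n)

  -- Newton's binomial series: (1-x)^{-b} = Σ (b)ₙ / n! · xⁿ.
  binomialSeries : Carrier → PowerSeries
  binomialSeries b n = pochhammer b n * fromNat (n !) ⁻¹

  -- w = ŵ(a; F | x) for F of degree m.
  IsEulerianPolynomial : Carrier → ℕ → Poly → Poly → Set
  IsEulerianPolynomial a m F w =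
    DegreeAtMost m w ×
    (∀ n → eval F (fromNat n) * (pochhammer a n * fromNat (n !) ⁻¹)
             ≈ (coeff w ⋆ binomialSeries (fromNat m + a)) n)

  -- The inclusion {a, a+1, …} ∩ [a, αₚ) ⊂ {α₁, …, αₚ} is stated for the
  -- points a + k, k ∈ ℕ, which automatically satisfy a ≤ a + k.
  Condition : Carrier → (p : ℕ) → (Fin p → Carrier) → Set
  Condition a zero    α = ⊤
  Condition a (suc p) α =
    0# ≤ α Fin.zero ×
    (∀ i j → i Fin.≤ j → α i ≤ α j) ×
    (∀ k → a + fromNat k < α (fromℕ p) → ∃[ i ] a + fromNat k ≈ α i)

{-# OPTIONS --safe #-}
module Submission where

-- Write w for the Eulerian polynomial of F = e (t + α₁) ... (t + αₘ). It is
-- built one zero at a time: if v / (1-x)^b is the generating function of G,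
-- then that of (α + t) G is the image of the former under α + x d/dx, which is
-- u / (1-x)^(b+1) with
--
--     u = (α (1-x) + b x) v + x (1-x) v′
--
-- (addZero, addZero-⋆). Since (1-x)^(-b) is a unit among the power series, w is
-- the polynomial obtained by iterating v ↦ u from the constant e
-- (eulerian-unique).
--
-- Invariant of the iteration: v is a constant times a product of d distinct
-- factors X - r with r < 0, and k = p - d, where p is the number of zeros used
-- so far, is such that these zeros are all less than a + k. Here b = p + a, so
-- if v has leading coefficient c, then u has coefficient (a + k - α) c at
-- X^(d+1). The condition on the zeros forces α ≤ a + k: otherwise a + k would
-- be one of the previous zeros. At a root r of v we have
-- u(r) = r (1-r) v′(r), so u alternates in sign along the roots of v, and
-- u(0) = α v(0) gives one more sign change between the largest root and 0 when
-- α > 0. If α < a + k, then u and v have opposite signs near minus infinity,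
-- whence another sign change and d + 1 negative roots of u in total
-- (regular-step). If α = a + k, the degree of u is at most d, its d roots found
-- so far suffice, and k grows by one (degenerate-step).
--
-- In the second part the last zero α may violate 0 < α ≤ a + k, and then
-- α (a + k - α) < 0. The sign changes between the roots of v leave a factor q
-- of u of degree at most 2, whose constant and quadratic coefficients have
-- product at most 0 (indefinite-step). Two distinct positive zeros of q, a
-- positive double zero, or a pair of conjugate zeros would force that product
-- to be positive (indefinite-zeros).

open import Defs
open import Algebra.Solver.Ring.AlmostCommutativeRing using (fromCommutativeRing; _-Raw-AlmostCommutative⟶_)
import Algebra.Properties.AbelianGroup as AbelianGroupProperties
import Algebra.Properties.Ring as RingProperties
import Algebra.Properties.Semiring.Mult as SemiringMult
import Algebra.Properties.Semiring.Mult.TCOptimised as Multiples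
import Algebra.Solver.Ring as RingSolver
open import Data.Empty using (⊥; ⊥-elim)
open import Data.Fin.Base as Fin using (Fin; inject₁; fromℕ)
import Data.Fin.Properties as Fin
open import Data.Fin.Relation.Unary.Top using (view; ‵fromℕ; ‵inject₁)
open import Data.Integer.Base as ℤ using (ℤ; +_; -[1+_]; +[1+_])
import Data.Integer.Properties as ℤ
open import Data.List.Base using (List; []; _∷_; map; foldr; length; _∷ʳ_)
import Data.List.Properties as List
open import Data.List.Relation.Unary.All as All using (All; []; _∷_)
import Data.List.Relation.Unary.All.Properties as All
open import Data.List.Relation.Unary.AllPairs as AllPairs using (AllPairs; []; _∷_)
import Data.List.Relation.Unary.AllPairs.Properties as AllPairs
open import Data.Maybe.Base using (Maybe; just; nothing)
open import Data.Nat.Base as ℕ using (ℕ; zero; suc; z≤n; s≤s; _!)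
import Data.Nat.Properties as ℕ
open import Data.Product.Base using (_×_; _,_; proj₁; proj₂; ∃-syntax)
open import Data.Sum.Base using (inj₁; inj₂)
import Data.Vec.Functional as Vector
import Relation.Binary.PropositionalEquality as ≡
open import Relation.Binary.Definitions using (Tri; tri<; tri≈; tri>)
open import Relation.Binary.Structures using (IsStrictTotalOrder)
open import Relation.Nullary using (¬_; yes; no)

module EulerianZeros (ℝ : CompleteOrderedField) where

  open CompleteOrderedField ℝ hiding (zero)
  open Eulerian ℝ

  -- Ring identities

  -- The ring solver with coefficients in the integers, mapped canonically to the
  -- reals. Equality of the coefficients is then decided by computation, which it
  -- has to be for opposite terms to cancel.
  module RingSolving where
    open Multiples semiring using (×-homo-+; ×1-homo-*; 1+×) renaming (_×_ to _×′_)
    open AbelianGroupProperties +-abelianGroup using (⁻¹-∙-comm)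
    open RingProperties ring using (-0#≈0#; -‿involutive; -‿distribˡ-*)
    open import Relation.Binary.Reasoning.Setoid setoid

    ⟦_⟧ℤ : ℤ → Carrier
    ⟦ + n      ⟧ℤ = n ×′ 1#
    ⟦ -[1+ n ] ⟧ℤ = - (suc n ×′ 1#)

    neg-homo : ∀ i → ⟦ ℤ.- i ⟧ℤ ≈ - ⟦ i ⟧ℤ
    neg-homo (+ 0)      = sym -0#≈0#
    neg-homo +[1+ n ]   = refl
    neg-homo (-[1+ n ]) = sym (-‿involutive _)

    cancel-1 : ∀ x y → (1# + x) - (1# + y) ≈ x - y
    cancel-1 x y = begin
      (1# + x) + - (1# + y)   ≈⟨ +-cong (+-comm 1# x) (sym (⁻¹-∙-comm 1# y)) ⟩
      (x + 1#) + (- 1# + - y) ≈⟨ +-assoc x 1# _ ⟩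
      x + (1# + (- 1# + - y)) ≈⟨ +-congˡ (sym (+-assoc 1# (- 1#) (- y))) ⟩
      x + ((1# + - 1#) + - y) ≈⟨ +-congˡ (+-congʳ (-‿inverseʳ 1#)) ⟩
      x + (0# + - y)          ≈⟨ +-congˡ (+-identityˡ (- y)) ⟩
      x - y                   ∎

    ⊖-homo : ∀ m n → ⟦ m ℤ.⊖ n ⟧ℤ ≈ m ×′ 1# - n ×′ 1#
    ⊖-homo m       0       = sym (trans (+-congˡ -0#≈0#) (+-identityʳ _))
    ⊖-homo 0       (suc n) = sym (+-identityˡ _)
    ⊖-homo (suc m) (suc n) = begin
      ⟦ suc m ℤ.⊖ suc n ⟧ℤ            ≡⟨ ≡.cong ⟦_⟧ℤ (ℤ.[1+m]⊖[1+n]≡m⊖n m n) ⟩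
      ⟦ m ℤ.⊖ n ⟧ℤ                    ≈⟨ ⊖-homo m n ⟩
      m ×′ 1# - n ×′ 1#               ≈⟨ cancel-1 _ _ ⟨
      (1# + m ×′ 1#) - (1# + n ×′ 1#) ≈⟨ +-cong (1+× m 1#) (-‿cong (1+× n 1#)) ⟨
      suc m ×′ 1# - suc n ×′ 1#       ∎

    +-homo : ∀ i j → ⟦ i ℤ.+ j ⟧ℤ ≈ ⟦ i ⟧ℤ + ⟦ j ⟧ℤ
    +-homo (+ m)    (+ n)    = ×-homo-+ 1# m n
    +-homo (+ m)    -[1+ n ] = ⊖-homo m (suc n)
    +-homo -[1+ m ] (+ n)    = trans (⊖-homo n (suc m)) (+-comm _ _)
    +-homo -[1+ m ] -[1+ n ] = begin
      - (suc (suc (m ℕ.+ n)) ×′ 1#)   ≡⟨ ≡.cong (λ k → - (suc k ×′ 1#)) (≡.sym (+-suc m n)) ⟩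
      - ((suc m ℕ.+ suc n) ×′ 1#)     ≈⟨ -‿cong (×-homo-+ 1# (suc m) (suc n)) ⟩
      - (suc m ×′ 1# + suc n ×′ 1#)   ≈⟨ ⁻¹-∙-comm _ _ ⟨
      - (suc m ×′ 1#) - suc n ×′ 1#   ∎
      where open import Data.Nat.Properties using (+-suc)

    +*+-homo : ∀ m n → ⟦ + m ℤ.* + n ⟧ℤ ≈ ⟦ + m ⟧ℤ * ⟦ + n ⟧ℤ
    +*+-homo m n = trans (reflexive (≡.cong ⟦_⟧ℤ (ℤ.+◃n≡+n (m ℕ.* n)))) (×1-homo-* m n)

    -*-homo : ∀ m j → ⟦ +[1+ m ] ℤ.* j ⟧ℤ ≈ ⟦ +[1+ m ] ⟧ℤ * ⟦ j ⟧ℤ →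
              ⟦ -[1+ m ] ℤ.* j ⟧ℤ ≈ ⟦ -[1+ m ] ⟧ℤ * ⟦ j ⟧ℤ
    -*-homo m j homo = begin
      ⟦ -[1+ m ] ℤ.* j ⟧ℤ         ≡⟨ ≡.cong ⟦_⟧ℤ (ℤ.neg-distribˡ-* +[1+ m ] j) ⟨
      ⟦ ℤ.- (+[1+ m ] ℤ.* j) ⟧ℤ   ≈⟨ neg-homo (+[1+ m ] ℤ.* j) ⟩
      - ⟦ +[1+ m ] ℤ.* j ⟧ℤ       ≈⟨ -‿cong homo ⟩
      - (⟦ +[1+ m ] ⟧ℤ * ⟦ j ⟧ℤ)  ≈⟨ -‿distribˡ-* _ _ ⟩
      ⟦ -[1+ m ] ⟧ℤ * ⟦ j ⟧ℤ      ∎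

    +*-homo : ∀ m j → ⟦ + m ℤ.* j ⟧ℤ ≈ ⟦ + m ⟧ℤ * ⟦ j ⟧ℤ
    +*-homo m (+ n)    = +*+-homo m n
    +*-homo m -[1+ n ] = begin
      ⟦ + m ℤ.* -[1+ n ] ⟧ℤ       ≡⟨ ≡.cong ⟦_⟧ℤ (ℤ.*-comm (+ m) -[1+ n ]) ⟩
      ⟦ -[1+ n ] ℤ.* + m ⟧ℤ       ≈⟨ -*-homo n (+ m) (+*+-homo (suc n) m) ⟩
      ⟦ -[1+ n ] ⟧ℤ * ⟦ + m ⟧ℤ    ≈⟨ *-comm _ _ ⟩
      ⟦ + m ⟧ℤ * ⟦ -[1+ n ] ⟧ℤ    ∎

    *-homo : ∀ i j → ⟦ i ℤ.* j ⟧ℤ ≈ ⟦ i ⟧ℤ * ⟦ j ⟧ℤ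
    *-homo (+ m)    j = +*-homo m j
    *-homo -[1+ m ] j = -*-homo m j (+*-homo (suc m) j)

    morphism : ℤ.+-*-rawRing -Raw-AlmostCommutative⟶ fromCommutativeRing commutativeRing
    morphism = record
      { ⟦_⟧ = ⟦_⟧ℤ ; +-homo = +-homo ; *-homo = *-homo ; -‿homo = neg-homo
      ; 0-homo = refl ; 1-homo = refl }

    sameCoefficient? : ∀ i j → Maybe (⟦ i ⟧ℤ ≈ ⟦ j ⟧ℤ)
    sameCoefficient? i j with i ℤ.≟ j
    ... | yes i≡j = just (reflexive (≡.cong ⟦_⟧ℤ i≡j))
    ... | no  _   = nothing

    open RingSolver _ _ morphism sameCoefficient? public
      using (solve; _:+_; _:*_; :-_; _:-_; _:=_; con; Polynomial)

    :0 :1 : ∀ {n} → Polynomial n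
    :0 = con (+ 0)
    :1 = con (+ 1)

  open RingSolving using (solve; _:+_; _:*_; :-_; _:-_; _:=_; :0; :1)

  -- Order and signs

  open IsStrictTotalOrder isStrictTotalOrder
    using (compare; irrefl; _<?_; <-respˡ-≈; <-respʳ-≈) renaming (trans to <-trans; _≟_ to _≈?_)

  +-pos : ∀ {x y} → 0# < x → 0# < y → 0# < x + y
  +-pos {x} {y} 0<x 0<y = <-trans 0<x (<-respˡ-≈ (+-identityʳ x) (+-monoʳ-< x 0<y))

  <⇒0<- : ∀ {x y} → x < y → 0# < y - x
  <⇒0<- {x} {y} x<y =
    <-respʳ-≈ (+-comm (- x) y) (<-respˡ-≈ (-‿inverseˡ x) (+-monoʳ-< (- x) x<y))

  0<-⇒< : ∀ {x y} → 0# < y - x → x < y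
  0<-⇒< {x} {y} h =
    <-respʳ-≈ (solve 2 (λ x y → x :+ (y :- x) := y) refl x y)
      (<-respˡ-≈ (+-identityʳ x) (+-monoʳ-< x h))

  neg⇒0<- : ∀ {x} → x < 0# → 0# < - x
  neg⇒0<- {x} x<0 = <-respʳ-≈ (+-identityˡ (- x)) (<⇒0<- x<0)

  0<-⇒neg : ∀ {x} → 0# < - x → x < 0#
  0<-⇒neg {x} h = 0<-⇒< (<-respʳ-≈ (sym (+-identityˡ (- x))) h)

  pos⇒≉0 : ∀ {x} → 0# < x → x ≉ 0#
  pos⇒≉0 0<x x≈0 = irrefl (sym x≈0) 0<x

  neg⇒≉0 : ∀ {x} → x < 0# → x ≉ 0#
  neg⇒≉0 x<0 x≈0 = irrefl x≈0 x<0

  <-asym : ∀ {x y} → x < y → ¬ (y < x)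
  <-asym x<y y<x = irrefl refl (<-trans x<y y<x)

  ≤-<-trans : ∀ {x y z} → x ≤ y → y < z → x < z
  ≤-<-trans (inj₁ x<y) y<z = <-trans x<y y<z
  ≤-<-trans (inj₂ x≈y) y<z = <-respˡ-≈ (sym x≈y) y<z

  <-≤-trans : ∀ {x y z} → x < y → y ≤ z → x < z
  <-≤-trans x<y (inj₁ y<z) = <-trans x<y y<z
  <-≤-trans x<y (inj₂ y≈z) = <-respʳ-≈ y≈z x<y

  ≤-<-irrefl : ∀ {x y} → x ≤ y → ¬ (y < x)
  ≤-<-irrefl x≤y y<x = irrefl refl (≤-<-trans x≤y y<x)

  ≤-trans : ∀ {x y z} → x ≤ y → y ≤ z → x ≤ z
  ≤-trans (inj₁ x<y) y≤z        = inj₁ (<-≤-trans x<y y≤z)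
  ≤-trans (inj₂ x≈y) (inj₁ y<z) = inj₁ (<-respˡ-≈ (sym x≈y) y<z)
  ≤-trans (inj₂ x≈y) (inj₂ y≈z) = inj₂ (trans x≈y y≈z)

  ≤-≉⇒< : ∀ {x y} → x ≤ y → x ≉ y → x < y
  ≤-≉⇒< (inj₁ x<y) _   = x<y
  ≤-≉⇒< (inj₂ x≈y) x≉y = ⊥-elim (x≉y x≈y)

  ≮⇒≥ : ∀ {x y} → ¬ (x < y) → y ≤ x
  ≮⇒≥ {x} {y} x≮y with compare x y
  ... | tri< x<y _ _ = ⊥-elim (x≮y x<y)
  ... | tri≈ _ x≈y _ = inj₂ (sym x≈y)
  ... | tri> _ _ y<x = inj₁ y<x

  neg*neg : ∀ {x y} → x < 0# → y < 0# → 0# < x * y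
  neg*neg {x} {y} x<0 y<0 =
    <-respʳ-≈ (solve 2 (λ x y → (:- x) :* (:- y) := x :* y) refl x y)
      (*-pos (neg⇒0<- x<0) (neg⇒0<- y<0))

  pos*neg : ∀ {x y} → 0# < x → y < 0# → x * y < 0#
  pos*neg {x} {y} 0<x y<0 = 0<-⇒neg
    (<-respʳ-≈ (solve 2 (λ x y → x :* (:- y) := :- (x :* y)) refl x y)
      (*-pos 0<x (neg⇒0<- y<0)))

  square-pos : ∀ {x} → x ≉ 0# → 0# < x * x
  square-pos {x} x≉0 with compare x 0#
  ... | tri< x<0 _ _ = neg*neg x<0 x<0
  ... | tri≈ _ x≈0 _ = ⊥-elim (x≉0 x≈0)
  ... | tri> _ _ 0<x = *-pos 0<x 0<x

  square-nonneg : ∀ x → 0# ≤ x * x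
  square-nonneg x with x ≈? 0#
  ... | yes x≈0 = inj₂ (sym (trans (*-congʳ x≈0) (zeroˡ x)))
  ... | no  x≉0 = inj₁ (square-pos x≉0)

  *-nonneg : ∀ {x y} → 0# ≤ x → 0# ≤ y → 0# ≤ x * y
  *-nonneg (inj₁ 0<x) (inj₁ 0<y) = inj₁ (*-pos 0<x 0<y)
  *-nonneg {x} {y} (inj₁ _) (inj₂ 0≈y) = inj₂ (trans (sym (zeroʳ x)) (*-congˡ 0≈y))
  *-nonneg {x} {y} (inj₂ 0≈x) _ = inj₂ (trans (sym (zeroˡ y)) (*-congʳ 0≈x))

  *-pos-cancelʳ : ∀ {x y} → 0# ≤ y → 0# < x * y → 0# < x
  *-pos-cancelʳ {x} {y} 0≤y 0<xy with compare 0# x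
  ... | tri< 0<x _ _ = 0<x
  ... | tri≈ _ 0≈x _ = ⊥-elim (pos⇒≉0 0<xy (trans (*-congʳ (sym 0≈x)) (zeroˡ y)))
  ... | tri> _ _ x<0 with 0≤y
  ...   | inj₁ 0<y = ⊥-elim (<-asym 0<xy (<-respˡ-≈ (*-comm y x) (pos*neg 0<y x<0)))
  ...   | inj₂ 0≈y = ⊥-elim (pos⇒≉0 0<xy (trans (*-congˡ (sym 0≈y)) (zeroʳ x)))

  *-≈0 : ∀ {x y} → x ≉ 0# → x * y ≈ 0# → y ≈ 0#
  *-≈0 {x} {y} x≉0 xy≈0 = begin
    y                ≈⟨ *-identityˡ y ⟨
    1# * y           ≈⟨ *-congʳ (*-inverseʳ x x≉0) ⟨
    (x * x ⁻¹) * y   ≈⟨ solve 3 (λ x z y → (x :* z) :* y := z :* (x :* y)) refl x (x ⁻¹) y ⟩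
    x ⁻¹ * (x * y)   ≈⟨ *-congˡ xy≈0 ⟩
    x ⁻¹ * 0#        ≈⟨ zeroʳ _ ⟩
    0#               ∎
    where open import Relation.Binary.Reasoning.Setoid setoid

  *-≉0 : ∀ {x y} → x ≉ 0# → y ≉ 0# → x * y ≉ 0#
  *-≉0 x≉0 y≉0 xy≈0 = y≉0 (*-≈0 x≉0 xy≈0)

  *-≉0⇒ˡ : ∀ {x y} → x * y ≉ 0# → x ≉ 0#
  *-≉0⇒ˡ {x} {y} h x≈0 = h (trans (*-congʳ x≈0) (zeroˡ y))

  *-≉0⇒ʳ : ∀ {x y} → x * y ≉ 0# → y ≉ 0#
  *-≉0⇒ʳ {x} {y} h y≈0 = h (trans (*-congˡ y≈0) (zeroʳ x))

  -‿≈0 : ∀ {x y} → x - y ≈ 0# → x ≈ y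
  -‿≈0 {x} {y} h = begin
    x           ≈⟨ solve 2 (λ x y → x := y :+ (x :- y)) refl x y ⟩
    y + (x - y) ≈⟨ +-congˡ h ⟩
    y + 0#      ≈⟨ +-identityʳ y ⟩
    y           ∎
    where open import Relation.Binary.Reasoning.Setoid setoid

  ⁻¹-pos : ∀ {x} → 0# < x → 0# < x ⁻¹
  ⁻¹-pos {x} 0<x = *-pos-cancelʳ (inj₁ 0<x)
    (<-respʳ-≈ (trans (sym (*-inverseʳ x (pos⇒≉0 0<x))) (*-comm x (x ⁻¹))) 0<1)

  -- Polynomials: coefficients

  coeff-+ₚ : ∀ p q n → coeff (p +ₚ q) n ≈ coeff p n + coeff q n
  coeff-+ₚ []      q       n       = sym (+-identityˡ _)
  coeff-+ₚ (c ∷ p) []      n       = sym (+-identityʳ _)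
  coeff-+ₚ (c ∷ p) (d ∷ q) zero    = refl
  coeff-+ₚ (c ∷ p) (d ∷ q) (suc n) = coeff-+ₚ p q n

  coeff-scale : ∀ c p n → coeff (map (c *_) p) n ≈ c * coeff p n
  coeff-scale c []      n       = sym (zeroʳ c)
  coeff-scale c (d ∷ p) zero    = refl
  coeff-scale c (d ∷ p) (suc n) = coeff-scale c p n

  coeff-X-*-zero : ∀ r q → coeff ((X- r) *ₚ q) 0 ≈ - r * coeff q 0
  coeff-X-*-zero r q = begin
    coeff (map (- r *_) q +ₚ (0# ∷ _)) 0 ≈⟨ coeff-+ₚ (map (- r *_) q) _ 0 ⟩
    coeff (map (- r *_) q) 0 + 0#        ≈⟨ +-identityʳ _ ⟩
    coeff (map (- r *_) q) 0             ≈⟨ coeff-scale (- r) q 0 ⟩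
    - r * coeff q 0                      ∎
    where open import Relation.Binary.Reasoning.Setoid setoid

  coeff-X-*-suc : ∀ r q n →
    coeff ((X- r) *ₚ q) (suc n) ≈ coeff q n - r * coeff q (suc n)
  coeff-X-*-suc r q n = begin
    coeff (map (- r *_) q +ₚ (0# ∷ 1*q+0)) (suc n)
      ≈⟨ coeff-+ₚ (map (- r *_) q) _ (suc n) ⟩
    coeff (map (- r *_) q) (suc n) + coeff 1*q+0 n
      ≈⟨ +-cong (coeff-scale (- r) q (suc n)) (coeff-+ₚ (map (1# *_) q) _ n) ⟩
    - r * coeff q (suc n) + (coeff (map (1# *_) q) n + coeff (0# ∷ []) n)
      ≈⟨ +-congˡ (+-cong (coeff-scale 1# q n) (coeff-0 n)) ⟩
    - r * coeff q (suc n) + (1# * coeff q n + 0#)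
      ≈⟨ solve 3 (λ r s t → (:- r) :* s :+ (:1 :* t :+ :0) := t :- r :* s) refl r _ _ ⟩
    coeff q n - r * coeff q (suc n) ∎
    where
    open import Relation.Binary.Reasoning.Setoid setoid
    1*q+0 : Poly
    1*q+0 = map (1# *_) q +ₚ (0# ∷ [])
    coeff-0 : ∀ n → coeff (0# ∷ []) n ≈ 0#
    coeff-0 zero    = refl
    coeff-0 (suc n) = refl

  X-*-cong : ∀ r p q → p ≈ₚ q → (X- r) *ₚ p ≈ₚ (X- r) *ₚ q
  X-*-cong r p q p≈q zero =
    trans (coeff-X-*-zero r p) (trans (*-congˡ (p≈q 0)) (sym (coeff-X-*-zero r q)))
  X-*-cong r p q p≈q (suc n) =
    trans (coeff-X-*-suc r p n)
      (trans (+-cong (p≈q n) (-‿cong (*-congˡ (p≈q (suc n))))) (sym (coeff-X-*-suc r q n)))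

  -- Evaluation in quadratic algebras

  -- The components of p(x + yθ) = evalRe + evalIm θ in the algebra generated over
  -- the reals by θ with θ² = δ. For δ = -1 it is the complex evaluation;
  -- for δ = 0 and y = 1 (dual numbers) the components are p(x) and p′(x).
  evalRe evalIm : (δ x y : Carrier) → Poly → Carrier
  evalRe δ x y []      = 0#
  evalRe δ x y (c ∷ p) = c + (x * evalRe δ x y p + δ * (y * evalIm δ x y p))
  evalIm δ x y []      = 0#
  evalIm δ x y (c ∷ p) = x * evalIm δ x y p + y * evalRe δ x y p

  module _ (δ x y : Carrier) where

    private
      Re Im : Poly → Carrier
      Re = evalRe δ x y
      Im = evalIm δ x y

    quadEval-zero : ∀ p → (∀ n → coeff p n ≈ 0#) → Re p ≈ 0# × Im p ≈ 0#
    quadEval-zero []      p≈0 = refl , refl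
    quadEval-zero (c ∷ p) p≈0 with quadEval-zero p (λ n → p≈0 (suc n))
    ... | Re≈0 , Im≈0 =
      trans (+-cong (p≈0 0) (+-cong (*-congˡ Re≈0) (*-congˡ (*-congˡ Im≈0))))
        (solve 3 (λ x y δ → :0 :+ (x :* :0 :+ δ :* (y :* :0)) := :0) refl x y δ) ,
      trans (+-cong (*-congˡ Im≈0) (*-congˡ Re≈0))
        (solve 2 (λ x y → x :* :0 :+ y :* :0 := :0) refl x y)

    quadEval-cong : ∀ p q → p ≈ₚ q → Re p ≈ Re q × Im p ≈ Im q
    quadEval-cong [] q p≈q with quadEval-zero q (λ n → sym (p≈q n))
    ... | Re≈0 , Im≈0 = sym Re≈0 , sym Im≈0
    quadEval-cong (c ∷ p) [] p≈q = quadEval-zero (c ∷ p) p≈q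
    quadEval-cong (c ∷ p) (d ∷ q) p≈q with quadEval-cong p q (λ n → p≈q (suc n))
    ... | Re≈ , Im≈ =
      +-cong (p≈q 0) (+-cong (*-congˡ Re≈) (*-congˡ (*-congˡ Im≈))) ,
      +-cong (*-congˡ Im≈) (*-congˡ Re≈)

    quadEval-+ : ∀ p q → Re (p +ₚ q) ≈ Re p + Re q × Im (p +ₚ q) ≈ Im p + Im q
    quadEval-+ []      q  = sym (+-identityˡ _) , sym (+-identityˡ _)
    quadEval-+ (c ∷ p) [] = sym (+-identityʳ _) , sym (+-identityʳ _)
    quadEval-+ (c ∷ p) (d ∷ q) with quadEval-+ p q
    ... | Re≈ , Im≈ =
      trans (+-congˡ (+-cong (*-congˡ Re≈) (*-congˡ (*-congˡ Im≈))))
        (solve 9 (λ c d x y δ u v u′ v′ →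
           (c :+ d) :+ (x :* (u :+ u′) :+ δ :* (y :* (v :+ v′)))
             := (c :+ (x :* u :+ δ :* (y :* v))) :+ (d :+ (x :* u′ :+ δ :* (y :* v′))))
           refl c d x y δ (Re p) (Im p) (Re q) (Im q)) ,
      trans (+-cong (*-congˡ Im≈) (*-congˡ Re≈))
        (solve 6 (λ x y u v u′ v′ →
           x :* (v :+ v′) :+ y :* (u :+ u′) := (x :* v :+ y :* u) :+ (x :* v′ :+ y :* u′))
           refl x y (Re p) (Im p) (Re q) (Im q))

    quadEval-scale : ∀ c p → Re (map (c *_) p) ≈ c * Re p × Im (map (c *_) p) ≈ c * Im p
    quadEval-scale c []      = sym (zeroʳ c) , sym (zeroʳ c)
    quadEval-scale c (d ∷ p) with quadEval-scale c p
    ... | Re≈ , Im≈ =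
      trans (+-congˡ (+-cong (*-congˡ Re≈) (*-congˡ (*-congˡ Im≈))))
        (solve 7 (λ c d x y δ u v →
           c :* d :+ (x :* (c :* u) :+ δ :* (y :* (c :* v)))
             := c :* (d :+ (x :* u :+ δ :* (y :* v))))
           refl c d x y δ (Re p) (Im p)) ,
      trans (+-cong (*-congˡ Im≈) (*-congˡ Re≈))
        (solve 5 (λ c x y u v → x :* (c :* v) :+ y :* (c :* u) := c :* (x :* v :+ y :* u))
           refl c x y (Re p) (Im p))

    quadEval-* : ∀ p q → Re (p *ₚ q) ≈ Re p * Re q + δ * (Im p * Im q)
                       × Im (p *ₚ q) ≈ Re p * Im q + Im p * Re q
    quadEval-* [] q =
      solve 3 (λ δ u v → :0 := :0 :* u :+ δ :* (:0 :* v)) refl δ (Re q) (Im q) ,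
      solve 2 (λ u v → :0 := :0 :* v :+ :0 :* u) refl (Re q) (Im q)
    quadEval-* (c ∷ p) q
      with quadEval-* p q | quadEval-scale c q | quadEval-+ (map (c *_) q) (0# ∷ p *ₚ q)
    ... | Re* , Im* | Re-c , Im-c | Re+ , Im+ =
      trans Re+ (trans
        (+-cong Re-c (+-congˡ (+-cong (*-congˡ Re*) (*-congˡ (*-congˡ Im*)))))
        (solve 8 (λ c x y δ u v u′ v′ →
           c :* u′ :+ (:0 :+ (x :* (u :* u′ :+ δ :* (v :* v′)) :+ δ :* (y :* (u :* v′ :+ v :* u′))))
             := (c :+ (x :* u :+ δ :* (y :* v))) :* u′ :+ δ :* ((x :* v :+ y :* u) :* v′))
           refl c x y δ (Re p) (Im p) (Re q) (Im q))) ,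
      trans Im+ (trans
        (+-cong Im-c (+-cong (*-congˡ Im*) (*-congˡ Re*)))
        (solve 8 (λ c x y δ u v u′ v′ →
           c :* v′ :+ (x :* (u :* v′ :+ v :* u′) :+ y :* (u :* u′ :+ δ :* (v :* v′)))
             := (c :+ (x :* u :+ δ :* (y :* v))) :* v′ :+ (x :* v :+ y :* u) :* u′)
           refl c x y δ (Re p) (Im p) (Re q) (Im q)))

    eval≈evalRe : δ * y ≈ 0# → ∀ p → eval p x ≈ Re p
    eval≈evalRe δy≈0 []      = refl
    eval≈evalRe δy≈0 (c ∷ p) = +-congˡ (begin
      x * eval p x                 ≈⟨ *-congˡ (eval≈evalRe δy≈0 p) ⟩
      x * Re p                     ≈⟨ solve 3 (λ x u v → x :* u := x :* u :+ :0 :* v) refl x (Re p) (Im p) ⟩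
      x * Re p + 0# * Im p         ≈⟨ +-congˡ (*-congʳ (sym δy≈0)) ⟩
      x * Re p + (δ * y) * Im p    ≈⟨ +-congˡ (*-assoc δ y (Im p)) ⟩
      x * Re p + δ * (y * Im p)    ∎)
      where open import Relation.Binary.Reasoning.Setoid setoid

  evalᶜ≈quadEval : ∀ p z → re (evalᶜ p z) ≈ evalRe (- 1#) (re z) (im z) p
                         × im (evalᶜ p z) ≈ evalIm (- 1#) (re z) (im z) p
  evalᶜ≈quadEval []      z = refl , refl
  evalᶜ≈quadEval (c ∷ p) z with evalᶜ≈quadEval p z
  ... | Re≈ , Im≈ =
    +-congˡ (trans (+-cong (*-congˡ Re≈) (-‿cong (*-congˡ Im≈)))
      (solve 4 (λ x y u v → x :* u :- y :* v := x :* u :+ (:- :1) :* (y :* v)) refl _ _ _ _)) ,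
    trans (+-identityˡ _) (+-cong (*-congˡ Im≈) (*-congˡ Re≈))

  -- The derivative of p at x.
  evalD : Poly → Carrier → Carrier
  evalD p x = evalIm 0# x 1# p

  private
    eval≈dual : ∀ p x → eval p x ≈ evalRe 0# x 1# p
    eval≈dual p x = eval≈evalRe 0# x 1# (zeroˡ 1#) p

  eval-cong : ∀ p q → p ≈ₚ q → ∀ x → eval p x ≈ eval q x
  eval-cong p q p≈q x =
    trans (eval≈dual p x) (trans (proj₁ (quadEval-cong 0# x 1# p q p≈q)) (sym (eval≈dual q x)))

  evalD-cong : ∀ p q → p ≈ₚ q → ∀ x → evalD p x ≈ evalD q x
  evalD-cong p q p≈q x = proj₂ (quadEval-cong 0# x 1# p q p≈q)

  eval-congʳ : ∀ p {x y} → x ≈ y → eval p x ≈ eval p y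
  eval-congʳ []      x≈y = refl
  eval-congʳ (c ∷ p) x≈y = +-congˡ (*-cong x≈y (eval-congʳ p x≈y))

  eval-zero : ∀ p x → (∀ n → coeff p n ≈ 0#) → eval p x ≈ 0#
  eval-zero p x p≈0 = trans (eval≈dual p x) (proj₁ (quadEval-zero 0# x 1# p p≈0))

  eval-* : ∀ p q x → eval (p *ₚ q) x ≈ eval p x * eval q x
  eval-* p q x = begin
    eval (p *ₚ q) x              ≈⟨ eval≈dual (p *ₚ q) x ⟩
    evalRe 0# x 1# (p *ₚ q)      ≈⟨ proj₁ (quadEval-* 0# x 1# p q) ⟩
    evalRe 0# x 1# p * evalRe 0# x 1# q + 0# * (evalD p x * evalD q x)
      ≈⟨ +-cong (*-cong (eval≈dual p x) (eval≈dual q x)) (sym (zeroˡ _)) ⟨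
    eval p x * eval q x + 0#     ≈⟨ +-identityʳ _ ⟩
    eval p x * eval q x          ∎
    where open import Relation.Binary.Reasoning.Setoid setoid

  evalD-* : ∀ p q x → evalD (p *ₚ q) x ≈ eval p x * evalD q x + evalD p x * eval q x
  evalD-* p q x = trans (proj₂ (quadEval-* 0# x 1# p q))
    (sym (+-cong (*-congʳ (eval≈dual p x)) (*-congˡ (eval≈dual q x))))

  eval-scale : ∀ c p x → eval (map (c *_) p) x ≈ c * eval p x
  eval-scale c p x = trans (eval≈dual (map (c *_) p) x)
    (trans (proj₁ (quadEval-scale 0# x 1# c p)) (*-congˡ (sym (eval≈dual p x))))

  eval-+ : ∀ p q x → eval (p +ₚ q) x ≈ eval p x + eval q x
  eval-+ p q x = trans (eval≈dual (p +ₚ q) x)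
    (trans (proj₁ (quadEval-+ 0# x 1# p q)) (sym (+-cong (eval≈dual p x) (eval≈dual q x))))

  evalD-∷ : ∀ c p x → evalD (c ∷ p) x ≈ eval p x + x * evalD p x
  evalD-∷ c p x = begin
    x * evalD p x + 1# * evalRe 0# x 1# p ≈⟨ +-congˡ (*-congˡ (sym (eval≈dual p x))) ⟩
    x * evalD p x + 1# * eval p x         ≈⟨ solve 2 (λ s t → s :+ :1 :* t := t :+ s) refl _ _ ⟩
    eval p x + x * evalD p x              ∎
    where open import Relation.Binary.Reasoning.Setoid setoid

  eval-X- : ∀ r x → eval (X- r) x ≈ x - r
  eval-X- r x = solve 2 (λ r x → (:- r) :+ x :* (:1 :+ x :* :0) := x :- r) refl r x

  evalD-X- : ∀ r x → evalD (X- r) x ≈ 1#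
  evalD-X- r x = solve 1 (λ x →
    x :* (x :* :0 :+ :1 :* :0) :+ :1 :* (:1 :+ (x :* :0 :+ :0 :* (:1 :* :0))) := :1) refl x

  eval-const : ∀ c x → eval (c ∷ []) x ≈ c
  eval-const c x = trans (+-congˡ (zeroʳ x)) (+-identityʳ c)

  degree-0 : ∀ p → DegreeAtMost 0 p → p ≈ₚ coeff p 0 ∷ []
  degree-0 p deg zero    = refl
  degree-0 p deg (suc n) = deg (suc n) (s≤s z≤n)

  eval-0 : ∀ p → eval p 0# ≈ coeff p 0
  eval-0 []      = refl
  eval-0 (c ∷ p) = trans (+-congˡ (zeroˡ _)) (+-identityʳ c)

  -- Products of linear factors

  -- The polynomial q · ∏ (X - r), r running through rs.
  withRoots : List Carrier → Poly → Poly
  withRoots rs q = foldr (λ r p → (X- r) *ₚ p) q rs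

  -- The values at x of ∏ (X - r) and of its derivative.
  ∏ : List Carrier → Carrier → Carrier
  ∏ []       x = 1#
  ∏ (r ∷ rs) x = (x - r) * ∏ rs x

  ∏′ : List Carrier → Carrier → Carrier
  ∏′ []       x = 0#
  ∏′ (r ∷ rs) x = ∏ rs x + (x - r) * ∏′ rs x

  eval-withRoots : ∀ rs q x → eval (withRoots rs q) x ≈ ∏ rs x * eval q x
  eval-withRoots []       q x = sym (*-identityˡ _)
  eval-withRoots (r ∷ rs) q x = begin
    eval ((X- r) *ₚ withRoots rs q) x        ≈⟨ eval-* (X- r) (withRoots rs q) x ⟩
    eval (X- r) x * eval (withRoots rs q) x  ≈⟨ *-cong (eval-X- r x) (eval-withRoots rs q x) ⟩
    (x - r) * (∏ rs x * eval q x)            ≈⟨ *-assoc _ _ _ ⟨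
    (x - r) * ∏ rs x * eval q x              ∎
    where open import Relation.Binary.Reasoning.Setoid setoid

  evalD-withRoots : ∀ rs q x →
    evalD (withRoots rs q) x ≈ ∏′ rs x * eval q x + ∏ rs x * evalD q x
  evalD-withRoots []       q x = solve 2 (λ u v → v := :0 :* u :+ :1 :* v) refl _ _
  evalD-withRoots (r ∷ rs) q x = begin
    evalD ((X- r) *ₚ p) x                            ≈⟨ evalD-* (X- r) p x ⟩
    eval (X- r) x * evalD p x + evalD (X- r) x * eval p x
      ≈⟨ +-cong (*-cong (eval-X- r x) (evalD-withRoots rs q x))
                (*-cong (evalD-X- r x) (eval-withRoots rs q x)) ⟩
    (x - r) * (∏′ rs x * eval q x + ∏ rs x * evalD q x) + 1# * (∏ rs x * eval q x)
      ≈⟨ solve 6 (λ x r a a′ b b′ →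
           (x :- r) :* (a′ :* b :+ a :* b′) :+ :1 :* (a :* b)
             := (a :+ (x :- r) :* a′) :* b :+ (x :- r) :* a :* b′)
           refl x r (∏ rs x) (∏′ rs x) (eval q x) (evalD q x) ⟩
    ∏′ (r ∷ rs) x * eval q x + ∏ (r ∷ rs) x * evalD q x ∎
    where
    open import Relation.Binary.Reasoning.Setoid setoid
    p : Poly
    p = withRoots rs q

  withRoots-cong : ∀ rs p q → p ≈ₚ q → withRoots rs p ≈ₚ withRoots rs q
  withRoots-cong []       p q p≈q = p≈q
  withRoots-cong (r ∷ rs) p q p≈q =
    X-*-cong r (withRoots rs p) (withRoots rs q) (withRoots-cong rs p q p≈q)

  withRoots-degree : ∀ rs {n q} → DegreeAtMost n q → DegreeAtMost (length rs ℕ.+ n) (withRoots rs q)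
  withRoots-degree []       deg = deg
  withRoots-degree (r ∷ rs) {q = q} deg (suc n) (s≤s l<n) = begin
    coeff ((X- r) *ₚ p) (suc n)      ≈⟨ coeff-X-*-suc r p n ⟩
    coeff p n - r * coeff p (suc n)  ≈⟨ +-cong (ih n l<n) (-‿cong (*-congˡ (ih (suc n) (ℕ.m<n⇒m<1+n l<n)))) ⟩
    0# - r * 0#                      ≈⟨ solve 1 (λ r → :0 :- r :* :0 := :0) refl r ⟩
    0#                               ∎
    where
    open import Relation.Binary.Reasoning.Setoid setoid
    p : Poly
    p = withRoots rs q
    ih : DegreeAtMost _ p
    ih = withRoots-degree rs deg

  withRoots-leading : ∀ rs {n q} → DegreeAtMost n q →
    coeff (withRoots rs q) (length rs ℕ.+ n) ≈ coeff q n
  withRoots-leading []       deg = refl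
  withRoots-leading (r ∷ rs) {n} {q} deg = begin
    coeff ((X- r) *ₚ p) (suc l)      ≈⟨ coeff-X-*-suc r p l ⟩
    coeff p l - r * coeff p (suc l)
      ≈⟨ +-cong (withRoots-leading rs deg) (-‿cong (*-congˡ (withRoots-degree rs deg (suc l) ℕ.≤-refl))) ⟩
    coeff q n - r * 0#               ≈⟨ solve 2 (λ c r → c :- r :* :0 := c) refl _ r ⟩
    coeff q n                        ∎
    where
    open import Relation.Binary.Reasoning.Setoid setoid
    p : Poly
    p = withRoots rs q
    l : ℕ
    l = length rs ℕ.+ n

  -- The factor theorem

  -- The quotient of p by X - r, up to the remainder p(r).
  quotient : Carrier → Poly → Poly
  quotient r []      = []
  quotient r (c ∷ p) = eval p r ∷ quotient r p

  quotient-coeff-zero : ∀ r p → coeff p 0 + r * coeff (quotient r p) 0 ≈ eval p r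
  quotient-coeff-zero r []      = trans (+-identityˡ _) (zeroʳ r)
  quotient-coeff-zero r (c ∷ p) = refl

  quotient-coeff-suc : ∀ r p n →
    coeff p (suc n) + r * coeff (quotient r p) (suc n) ≈ coeff (quotient r p) n
  quotient-coeff-suc r []      n       = trans (+-identityˡ _) (zeroʳ r)
  quotient-coeff-suc r (c ∷ p) zero    = quotient-coeff-zero r p
  quotient-coeff-suc r (c ∷ p) (suc n) = quotient-coeff-suc r p n

  eval-quotient : ∀ r p x → eval p x ≈ eval p r + (x - r) * eval (quotient r p) x
  eval-quotient r []      x = sym (trans (+-identityˡ _) (zeroʳ _))
  eval-quotient r (c ∷ p) x = trans (+-congˡ (*-congˡ (eval-quotient r p x)))
    (solve 5 (λ c x r u v → c :+ x :* (u :+ (x :- r) :* v) := (c :+ r :* u) :+ (x :- r) :* (u :+ x :* v))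
       refl c x r (eval p r) (eval (quotient r p) x))

  factor-root : ∀ r p → eval p r ≈ 0# → p ≈ₚ (X- r) *ₚ quotient r p
  factor-root r p root zero = sym (begin
    coeff ((X- r) *ₚ q) 0  ≈⟨ coeff-X-*-zero r q ⟩
    - r * coeff q 0        ≈⟨ solve 3 (λ r s t → (:- r) :* s := t :- (t :+ r :* s)) refl r _ (coeff p 0) ⟩
    coeff p 0 - (coeff p 0 + r * coeff q 0) ≈⟨ +-congˡ (-‿cong (trans (quotient-coeff-zero r p) root)) ⟩
    coeff p 0 - 0#         ≈⟨ solve 1 (λ t → t :- :0 := t) refl _ ⟩
    coeff p 0              ∎)
    where
    open import Relation.Binary.Reasoning.Setoid setoid
    q : Poly
    q = quotient r p
  factor-root r p root (suc n) = sym (begin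
    coeff ((X- r) *ₚ q) (suc n)      ≈⟨ coeff-X-*-suc r q n ⟩
    coeff q n - r * coeff q (suc n)  ≈⟨ +-congʳ (sym (quotient-coeff-suc r p n)) ⟩
    (coeff p (suc n) + r * coeff q (suc n)) - r * coeff q (suc n)
      ≈⟨ solve 2 (λ s t → (s :+ t) :- t := s) refl _ _ ⟩
    coeff p (suc n)                  ∎)
    where
    open import Relation.Binary.Reasoning.Setoid setoid
    q : Poly
    q = quotient r p

  quotient-degree : ∀ r n p → (∀ j → n ℕ.≤ j → coeff p (suc j) ≈ 0#) →
    ∀ j → n ℕ.≤ j → coeff (quotient r p) j ≈ 0#
  quotient-degree r n       []      deg j       n≤j       = refl
  quotient-degree r zero    (c ∷ p) deg zero    n≤j       = eval-zero p r (λ i → deg i z≤n)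
  quotient-degree r zero    (c ∷ p) deg (suc j) n≤j       =
    quotient-degree r 0 p (λ i _ → deg (suc i) z≤n) j z≤n
  quotient-degree r (suc n) (c ∷ p) deg (suc j) (s≤s n≤j) =
    quotient-degree r n p (λ i n≤i → deg (suc i) (s≤s n≤i)) j n≤j

  factor-roots : ∀ rs n p → AllPairs _<_ rs → All (λ r → eval p r ≈ 0#) rs →
    DegreeAtMost (length rs ℕ.+ n) p → ∃[ q ] DegreeAtMost n q × p ≈ₚ withRoots rs q
  factor-roots []       n p []              []             deg = p , deg , λ _ → refl
  factor-roots (r ∷ rs) n p (r<rs ∷ sorted) (root ∷ roots) deg =
    let p₁ = quotient r p
        p≈ = factor-root r p root
        roots₁ = All.zipWith
          (λ {s} (r<s , ps≈0) → *-≈0 (pos⇒≉0 (<⇒0<- r<s))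
            (trans (sym (trans (eval-* (X- r) p₁ s) (*-congʳ (eval-X- r s))))
                   (trans (sym (eval-cong p ((X- r) *ₚ p₁) p≈ s)) ps≈0)))
          (r<rs , roots)
        q , deg-q , p₁≈ = factor-roots rs n p₁ sorted roots₁
          (quotient-degree r (suc (length rs ℕ.+ n)) p λ j l<j → deg (suc j) (s≤s l<j))
    in q , deg-q , λ k → trans (p≈ k) (X-*-cong r p₁ (withRoots rs q) p₁≈ k)

  -- The intermediate value theorem

  -- -K < x < K.
  Within : Carrier → Carrier → Set
  Within K x = 0# < K - x × 0# < K + x

  within-some : ∀ x → ∃[ K ] 0# < K × Within K x
  within-some x with compare x 0#
  ... | tri< x<0 _ _ = 1# - x , +-pos 0<1 (neg⇒0<- x<0) ,
    +-pos (+-pos 0<1 (neg⇒0<- x<0)) (neg⇒0<- x<0) ,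
    <-respʳ-≈ (solve 1 (λ x → :1 := :1 :- x :+ x) refl x) 0<1
  ... | tri≈ _ x≈0 _ = 1# , 0<1 ,
    <-respʳ-≈ (sym (trans (+-congˡ (-‿cong x≈0)) (solve 0 (:1 :- :0 := :1) refl))) 0<1 ,
    <-respʳ-≈ (sym (trans (+-congˡ x≈0) (+-identityʳ 1#))) 0<1
  ... | tri> _ _ 0<x = 1# + x , +-pos 0<1 0<x ,
    <-respʳ-≈ (solve 1 (λ x → :1 := (:1 :+ x) :- x) refl x) 0<1 ,
    +-pos (+-pos 0<1 0<x) 0<x

  -- Both bounds of the product come from expanding (R ∓ x)(K + y) + (R ± x)(K - y).
  within-* : ∀ {R K x y} → Within R x → Within K y → Within (R * K) (x * y)
  within-* {R} {K} {x} {y} (R-x , R+x) (K-y , K+y) =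
    halve (+-pos (*-pos R-x K+y) (*-pos R+x K-y))
      (solve 4 (λ R K x y → (R :- x) :* (K :+ y) :+ (R :+ x) :* (K :- y) :=
         (R :* K :- x :* y) :* (:1 :+ :1)) refl R K x y) ,
    halve (+-pos (*-pos R-x K-y) (*-pos R+x K+y))
      (solve 4 (λ R K x y → (R :- x) :* (K :- y) :+ (R :+ x) :* (K :+ y) :=
         (R :* K :+ x :* y) :* (:1 :+ :1)) refl R K x y)
    where
    halve : ∀ {s t} → 0# < s → s ≈ t * (1# + 1#) → 0# < t
    halve 0<s s≈2t = *-pos-cancelʳ (inj₁ (+-pos 0<1 0<1)) (<-respʳ-≈ s≈2t 0<s)

  within-+ : ∀ {R K x y} → Within R x → Within K y → Within (R + K) (x + y)
  within-+ {R} {K} {x} {y} (R-x , R+x) (K-y , K+y) =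
    <-respʳ-≈ (solve 4 (λ R K x y → (R :- x) :+ (K :- y) := (R :+ K) :- (x :+ y)) refl R K x y)
      (+-pos R-x K-y) ,
    <-respʳ-≈ (solve 4 (λ R K x y → (R :+ x) :+ (K :+ y) := (R :+ K) :+ (x :+ y)) refl R K x y)
      (+-pos R+x K+y)

  bounded : ∀ {R} → 0# < R → ∀ p → ∃[ K ] 0# < K × (∀ x → Within R x → Within K (eval p x))
  bounded 0<R []      = 1# , 0<1 , λ x _ →
    <-respʳ-≈ (solve 0 (:1 := :1 :- :0) refl) 0<1 , <-respʳ-≈ (sym (+-identityʳ 1#)) 0<1
  bounded {R} 0<R (c ∷ p) =
    let C , 0<C , |c|<C = within-some c
        K , 0<K , |p|<K = bounded 0<R p
    in C + R * K , +-pos 0<C (*-pos 0<R 0<K) ,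
       λ x |x|<R → within-+ |c|<C (within-* |x|<R (|p|<K x |x|<R))

  -- Some δ > 0 satisfies δ < A and δ K < B, namely A B / (A K + B).
  small : ∀ {A B K} → 0# < A → 0# < B → 0# < K → ∃[ δ ] 0# < δ × 0# < A - δ × 0# < B - δ * K
  small {A} {B} {K} 0<A 0<B 0<K = A * B * i , *-pos (*-pos 0<A 0<B) 0<i ,
    <-respʳ-≈ (begin
      A * (A * K) * i                  ≈⟨ solve 4 (λ A B K i → A :* (A :* K) :* i := A :* ((A :* K :+ B) :* i) :- A :* B :* i) refl A B K i ⟩
      A * ((A * K + B) * i) - A * B * i ≈⟨ +-congʳ (trans (*-congˡ inv) (*-identityʳ A)) ⟩
      A - A * B * i                    ∎) (*-pos (*-pos 0<A (*-pos 0<A 0<K)) 0<i) ,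
    <-respʳ-≈ (begin
      B * B * i                        ≈⟨ solve 4 (λ A B K i → B :* B :* i := B :* ((A :* K :+ B) :* i) :- A :* B :* i :* K) refl A B K i ⟩
      B * ((A * K + B) * i) - A * B * i * K ≈⟨ +-congʳ (trans (*-congˡ inv) (*-identityʳ B)) ⟩
      B - A * B * i * K                ∎) (*-pos (*-pos 0<B 0<B) 0<i)
    where
    open import Relation.Binary.Reasoning.Setoid setoid
    i : Carrier
    i = (A * K + B) ⁻¹
    0<S : 0# < A * K + B
    0<S = +-pos (*-pos 0<A 0<K) 0<B
    0<i : 0# < i
    0<i = ⁻¹-pos 0<S
    inv : (A * K + B) * i ≈ 1#
    inv = *-inverseʳ _ (pos⇒≉0 0<S)

  bounded-on : ∀ {l h} p → ∃[ K ] 0# < K × (∀ x → l ≤ x → x ≤ h → 0# < K - eval p x)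
  bounded-on {l} {h} p =
    let L , 0<L , _ , 0<L+l = within-some l
        H , 0<H , 0<H-h , _ = within-some h
        K , 0<K , |p|<K     = bounded (+-pos 0<L 0<H) p
    in K , 0<K , λ x l≤x x≤h → proj₁ (|p|<K x
      ( 0<-+ (+-pos 0<H-h 0<L) x≤h
          (solve 4 (λ L H h x → ((H :- h) :+ L) :+ (h :- x) := (L :+ H) :- x) refl L H h x)
      , 0<-+ (+-pos 0<L+l 0<H) l≤x
          (solve 4 (λ L H l x → ((L :+ l) :+ H) :+ (x :- l) := (L :+ H) :+ x) refl L H l x)))
    where
    0<-+ : ∀ {a b c d} → 0# < a → b ≤ c → a + (c - b) ≈ d → 0# < d
    0<-+ 0<a b≤c eq = <-respʳ-≈ eq (<-≤-trans 0<a (≤-+ b≤c))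
      where
      ≤-+ : ∀ {a b c} → b ≤ c → a ≤ a + (c - b)
      ≤-+ {a} (inj₁ b<c) = inj₁ (<-respˡ-≈ (+-identityʳ a) (+-monoʳ-< a (<⇒0<- b<c)))
      ≤-+ {a} (inj₂ b≈c) = inj₂ (trans (sym (+-identityʳ a))
        (+-congˡ (sym (trans (+-congˡ (-‿cong b≈c)) (-‿inverseʳ _)))))

  -- The points of (-∞ , h] at which p is negative.
  NegativeUpTo : Poly → Carrier → Carrier → Set
  NegativeUpTo p h x = x ≤ h × eval p x < 0#

  -- The supremum s of these points is a root: p(x) = p(s) + (x - s) q(x) with q
  -- bounded by K, so p keeps its sign near s.
  module _ (p : Poly) {l h : Carrier} (l<h : l < h) (pl<0 : eval p l < 0#) (0<ph : 0# < eval p h)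
    (s : Carrier) (upper : IsUpperBound (NegativeUpTo p h) s)
    (least : ∀ u → IsUpperBound (NegativeUpTo p h) u → s ≤ u)
    (K : Carrier) (0<K : 0# < K)
    (q<K : ∀ x → l ≤ x → x ≤ h → 0# < K - eval (quotient s p) x)
    where

    private
      l≤s : l ≤ s
      l≤s = upper l (inj₁ l<h , pl<0)
      s≤h : s ≤ h
      s≤h = least h (λ x → proj₁)

    not-neg : ¬ (eval p s < 0#)
    not-neg ps<0 =
      let s<h = ≤-≉⇒< s≤h λ s≈h → <-asym 0<ph (<-respˡ-≈ (eval-congʳ p s≈h) ps<0)
          δ , 0<δ , 0<h-s-δ , 0<-ps-δK = small (<⇒0<- s<h) (neg⇒0<- ps<0) 0<K
      in stepRight δ 0<δ 0<h-s-δ 0<-ps-δK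
      where
      stepRight : ∀ δ → 0# < δ → 0# < (h - s) - δ → 0# < - eval p s - δ * K → ⊥
      stepRight δ 0<δ 0<h-s-δ 0<-ps-δK = ≤-<-irrefl (upper x (inj₁ x<h , px<0)) s<x
       where
       x : Carrier
       x = s + δ
       s<x : s < x
       s<x = 0<-⇒< (<-respʳ-≈ (solve 2 (λ s δ → δ := (s :+ δ) :- s) refl s δ) 0<δ)
       x<h : x < h
       x<h = 0<-⇒< (<-respʳ-≈ (solve 3 (λ s δ h → (h :- s) :- δ := h :- (s :+ δ)) refl s δ h) 0<h-s-δ)
       px<0 : eval p x < 0#
       px<0 = 0<-⇒neg (<-respʳ-≈
         (trans (solve 5 (λ s δ K u v → ((:- u) :- δ :* K) :+ δ :* (K :- v) := :- (u :+ ((s :+ δ) :- s) :* v))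
                   refl s δ K (eval p s) (eval (quotient s p) x))
                (-‿cong (sym (eval-quotient s p x))))
         (+-pos 0<-ps-δK (*-pos 0<δ (q<K x (inj₁ (≤-<-trans l≤s s<x)) (inj₁ x<h)))))

    not-pos : ¬ (0# < eval p s)
    not-pos 0<ps =
      let l<s = ≤-≉⇒< l≤s λ l≈s → <-asym 0<ps (<-respˡ-≈ (eval-congʳ p l≈s) pl<0)
          δ , 0<δ , 0<s-l-δ , 0<ps-δK = small (<⇒0<- l<s) 0<ps 0<K
      in stepLeft δ 0<δ 0<s-l-δ 0<ps-δK
      where
      stepLeft : ∀ δ → 0# < δ → 0# < (s - l) - δ → 0# < eval p s - δ * K → ⊥
      stepLeft δ 0<δ 0<s-l-δ 0<ps-δK =
       ≤-<-irrefl (least (s - δ) λ y y∈ → ≮⇒≥ (positive y y∈)) s-δ<s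
       where
       s-δ<s : s - δ < s
       s-δ<s = 0<-⇒< (<-respʳ-≈ (solve 2 (λ s δ → δ := s :- (s :- δ)) refl s δ) 0<δ)
       l<s-δ : l < s - δ
       l<s-δ = 0<-⇒< (<-respʳ-≈ (solve 3 (λ s δ l → (s :- l) :- δ := (s :- δ) :- l) refl s δ l) 0<s-l-δ)
       positive : ∀ y → NegativeUpTo p h y → ¬ (s - δ < y)
       positive y y∈@(y≤h , py<0) s-δ<y = ≤-<-irrefl (*-nonneg 0≤s-y (inj₁ (q<K y (inj₁ (<-trans l<s-δ s-δ<y)) y≤h)))
         (0<-⇒neg (<-respʳ-≈
           (trans (+-congˡ (-‿cong (eval-quotient s p y)))
             (solve 6 (λ s δ y K u v →
                (u :- δ :* K) :+ (y :- (s :- δ)) :* K :- (u :+ (y :- s) :* v) := :- ((s :- y) :* (K :- v)))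
                refl s δ y K (eval p s) (eval (quotient s p) y)))
           (+-pos (+-pos 0<ps-δK (*-pos (<⇒0<- s-δ<y) 0<K)) (neg⇒0<- py<0))))
         where
         0≤s-y : 0# ≤ s - y
         0≤s-y with upper y y∈
         ... | inj₁ y<s = inj₁ (<⇒0<- y<s)
         ... | inj₂ y≈s = inj₂ (sym (trans (+-congˡ (-‿cong y≈s)) (-‿inverseʳ s)))

    supremum-root : l < s × s < h × eval p s ≈ 0#
    supremum-root with compare (eval p s) 0#
    ... | tri< ps<0 _ _ = ⊥-elim (not-neg ps<0)
    ... | tri> _ _ 0<ps = ⊥-elim (not-pos 0<ps)
    ... | tri≈ _ ps≈0 _ =
      ≤-≉⇒< l≤s (λ l≈s → neg⇒≉0 pl<0 (trans (eval-congʳ p l≈s) ps≈0)) ,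
      ≤-≉⇒< s≤h (λ s≈h → pos⇒≉0 0<ph (trans (eval-congʳ p (sym s≈h)) ps≈0)) , ps≈0

  root-between-neg-pos : ∀ p {l h} → l < h → eval p l < 0# → 0# < eval p h →
    ∃[ s ] l < s × s < h × eval p s ≈ 0#
  root-between-neg-pos p {l} {h} l<h pl<0 0<ph =
    let s , upper , least = supremum (NegativeUpTo p h) (l , inj₁ l<h , pl<0) (h , λ x → proj₁)
        K , 0<K , q<K     = bounded-on (quotient s p)
    in s , supremum-root p l<h pl<0 0<ph s upper least K 0<K q<K

  root-between : ∀ p {l h} → l < h → eval p l * eval p h < 0# →
    ∃[ s ] l < s × s < h × eval p s ≈ 0#
  root-between p {l} {h} l<h change with compare (eval p l) 0#
  ... | tri≈ _ pl≈0 _ = ⊥-elim (neg⇒≉0 change (trans (*-congʳ pl≈0) (zeroˡ _)))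
  ... | tri< pl<0 _ _ = root-between-neg-pos p l<h pl<0
    (*-pos-cancelʳ (inj₁ (neg⇒0<- pl<0)) (<-respʳ-≈
      (solve 2 (λ u v → :- (u :* v) := v :* (:- u)) refl _ _) (neg⇒0<- change)))
  ... | tri> _ _ 0<pl =
    let s , l<s , s<h , -ps≈0 = root-between-neg-pos (map (- 1# *_) p) l<h
          (0<-⇒neg (<-respʳ-≈ (trans (solve 1 (λ u → u := :- ((:- :1) :* u)) refl _) (-‿cong (sym (eval-scale (- 1#) p l)))) 0<pl))
          (<-respʳ-≈ (sym (eval-scale (- 1#) p h))
            (*-pos-cancelʳ (inj₁ 0<pl) (<-respʳ-≈
              (solve 2 (λ u v → :- (u :* v) := ((:- :1) :* v) :* u) refl _ _) (neg⇒0<- change))))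
    in s , l<s , s<h ,
       trans (solve 1 (λ u → u := (:- :1) :* ((:- :1) :* u)) refl _)
         (trans (*-congˡ (trans (sym (eval-scale (- 1#) p s)) -ps≈0)) (zeroʳ _))

  -- Signs of products of linear factors

  ∏-root : ∀ rs → All (λ r → ∏ rs r ≈ 0#) rs
  ∏-root []       = []
  ∏-root (r ∷ rs) =
    trans (*-congʳ (-‿inverseʳ r)) (zeroˡ _) ∷
    All.map (λ root → trans (*-congˡ root) (zeroʳ _)) (∏-root rs)

  ∏-pos : ∀ {rs x} → All (_< x) rs → 0# < ∏ rs x
  ∏-pos []            = 0<1
  ∏-pos (r<x ∷ rs<x) = *-pos (<⇒0<- r<x) (∏-pos rs<x)

  ∏-same-sign : ∀ {rs x y} → All (x <_) rs → All (y <_) rs → 0# < ∏ rs x * ∏ rs y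
  ∏-same-sign [] [] = <-respʳ-≈ (sym (*-identityˡ 1#)) 0<1
  ∏-same-sign {r ∷ rs} {x} {y} (x<r ∷ x<rs) (y<r ∷ y<rs) = <-respʳ-≈
    (solve 5 (λ r x y s t → ((r :- x) :* (r :- y)) :* (s :* t) := ((x :- r) :* s) :* ((y :- r) :* t))
       refl r x y (∏ rs x) (∏ rs y))
    (*-pos (*-pos (<⇒0<- x<r) (<⇒0<- y<r)) (∏-same-sign x<rs y<rs))

  ∏-≉0 : ∀ {rs x} → All (x <_) rs → ∏ rs x ≉ 0#
  ∏-≉0 x<rs = *-≉0⇒ˡ (pos⇒≉0 (∏-same-sign x<rs x<rs))

  ∏′-head : ∀ r rs → ∏′ (r ∷ rs) r ≈ ∏ rs r
  ∏′-head r rs = solve 3 (λ r s t → s :+ (r :- r) :* t := s) refl r (∏ rs r) (∏′ rs r)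

  ∏′-tail : ∀ r rs {t} → ∏ rs t ≈ 0# → ∏′ (r ∷ rs) t ≈ (t - r) * ∏′ rs t
  ∏′-tail r rs root = trans (+-congʳ root) (+-identityˡ _)

  ∏′-≉0 : ∀ {rs} → AllPairs _<_ rs → All (λ r → ∏′ rs r ≉ 0#) rs
  ∏′-≉0 []              = []
  ∏′-≉0 {r ∷ rs} (r<rs ∷ sorted) =
    (λ h → ∏-≉0 r<rs (trans (sym (∏′-head r rs)) h)) ∷
    All.zipWith (λ {t} (r<t , root , simple) h →
        *-≉0 (pos⇒≉0 (<⇒0<- r<t)) simple (trans (sym (∏′-tail r rs root)) h))
      (r<rs , All.zip (∏-root rs , ∏′-≉0 sorted))

  ∏-∷ʳ : ∀ rs e x → ∏ (rs ∷ʳ e) x ≈ ∏ rs x * (x - e)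
  ∏-∷ʳ []       e x = *-comm _ _
  ∏-∷ʳ (r ∷ rs) e x = trans (*-congˡ (∏-∷ʳ rs e x)) (sym (*-assoc _ _ _))

  ∏′-∷ʳ : ∀ rs e x → ∏′ (rs ∷ʳ e) x ≈ ∏′ rs x * (x - e) + ∏ rs x
  ∏′-∷ʳ []       e x = solve 1 (λ t → :1 :+ t :* :0 := :0 :* t :+ :1) refl (x - e)
  ∏′-∷ʳ (r ∷ rs) e x = trans (+-cong (∏-∷ʳ rs e x) (*-congˡ (∏′-∷ʳ rs e x)))
    (solve 4 (λ s s′ t u → s :* u :+ t :* (s′ :* u :+ s) := (s :+ t :* s′) :* u :+ t :* s)
       refl (∏ rs x) (∏′ rs x) (x - r) (x - e))

  -- Interlacing

  -- If, up to the constant κ, p has the sign of the derivative of ∏ (X - t) at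
  -- each of the increasing points t, then p has a root strictly between any two
  -- consecutive points. The roots are bounded below by r and above by any bound M
  -- of the points, which is all that is needed about their location.
  interlace-∷ : ∀ κ p r rs {M} → AllPairs _<_ (r ∷ rs) → All (_≤ M) rs →
    All (λ t → 0# < κ * (eval p t * ∏′ (r ∷ rs) t)) (r ∷ rs) →
    ∃[ ss ] length ss ≡.≡ length rs × AllPairs _<_ (r ∷ ss) × All (_< M) ss ×
            All (λ s → eval p s ≈ 0#) ss
  interlace-∷ κ p r [] _ _ _ = [] , ≡.refl , [] ∷ [] , [] , []
  interlace-∷ κ p r (r′ ∷ rs) {M} (r<@(r<r′ ∷ r<rs) ∷ sorted@(r′<rs ∷ _)) (r′≤M ∷ rs≤M) (sign-r ∷ signs) =
    let tail-signs = All.zipWith (λ {t} (r<t , root , sign) → tail-sign t r<t root sign)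
                       (r< , All.zip (∏-root (r′ ∷ rs) , signs))
        ss , length≡ , r′∷ss-sorted , ss<M , roots = interlace-∷ κ p r′ rs {M} sorted rs≤M tail-signs
        s , r<s , s<r′ , root = root-between p r<r′ (change (All.head tail-signs))
        s<ss = All.map (<-trans s<r′) (AllPairs.head r′∷ss-sorted)
    in s ∷ ss , ≡.cong suc length≡ ,
       (r<s ∷ All.map (<-trans r<s) s<ss) ∷ s<ss ∷ AllPairs.tail r′∷ss-sorted ,
       <-≤-trans s<r′ r′≤M ∷ ss<M , root ∷ roots
    where
    tail-sign : ∀ t → r < t → ∏ (r′ ∷ rs) t ≈ 0# →
      0# < κ * (eval p t * ∏′ (r ∷ r′ ∷ rs) t) → 0# < κ * (eval p t * ∏′ (r′ ∷ rs) t)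
    tail-sign t r<t root sign = *-pos-cancelʳ (inj₁ (<⇒0<- r<t)) (<-respʳ-≈
      (trans (*-congˡ (*-congˡ (∏′-tail r (r′ ∷ rs) root)))
        (solve 4 (λ k u v w → k :* (u :* (v :* w)) := k :* (u :* w) :* v) refl κ (eval p t) (t - r) (∏′ (r′ ∷ rs) t)))
      sign)

    -- The remaining factors X - t, t in rs, have the same sign at r and r′.
    change : 0# < κ * (eval p r′ * ∏′ (r′ ∷ rs) r′) → eval p r * eval p r′ < 0#
    change sign-r′ = 0<-⇒neg (*-pos-cancelʳ
      (*-nonneg (*-nonneg (square-nonneg κ) (square-nonneg (∏ rs r * ∏ rs r′))) (inj₁ (<⇒0<- r<r′)))
      (<-respʳ-≈
        (trans (*-cong (*-cong (*-congˡ (*-congˡ (∏′-head r (r′ ∷ rs)))) (*-congˡ (*-congˡ (∏′-head r′ rs)))) refl)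
          (solve 7 (λ k u u′ r r′ v v′ →
            (k :* (u :* ((r :- r′) :* v)) :* (k :* (u′ :* v′))) :* (v :* v′)
              := (:- (u :* u′)) :* ((k :* k) :* ((v :* v′) :* (v :* v′)) :* (r′ :- r)))
            refl κ (eval p r) (eval p r′) r r′ (∏ rs r) (∏ rs r′)))
        (*-pos (*-pos sign-r sign-r′) (∏-same-sign r<rs r′<rs))))

  interlace : ∀ κ p rs {M} → AllPairs _<_ rs → All (_≤ M) rs →
    All (λ t → 0# < κ * (eval p t * ∏′ rs t)) rs →
    ∃[ ss ] length ss ≡.≡ ℕ.pred (length rs) × AllPairs _<_ ss × All (_< M) ss ×
            All (λ s → eval p s ≈ 0#) ss
  interlace κ p []       _      _            _     = [] , ≡.refl , [] , [] , []
  interlace κ p (r ∷ rs) sorted (_ ∷ rs≤M) signs =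
    let ss , length≡ , r∷ss-sorted , rest = interlace-∷ κ p r rs sorted rs≤M signs
    in ss , length≡ , AllPairs.tail r∷ss-sorted , rest

  -- Signs near minus infinity

  -- (-1)ⁿ.
  alternating : ℕ → Carrier
  alternating zero    = 1#
  alternating (suc n) = - alternating n

  lower-bound : ∀ x y → ∃[ m ] m ≤ x × m ≤ y
  lower-bound x y with compare x y
  ... | tri< x<y _ _ = x , inj₂ refl , inj₁ x<y
  ... | tri≈ _ x≈y _ = x , inj₂ refl , inj₂ x≈y
  ... | tri> _ _ y<x = y , inj₁ y<x , inj₂ refl

  strict-lower-bound : ∀ x → x - 1# < x
  strict-lower-bound x = 0<-⇒< (<-respʳ-≈ (solve 1 (λ x → :1 := x :- (x :- :1)) refl x) 0<1)

  list-lower-bound : ∀ xs → ∃[ m ] All (m ≤_) xs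
  list-lower-bound []       = 0# , []
  list-lower-bound (x ∷ xs) =
    let m , m≤xs = list-lower-bound xs
        m′ , m′≤x , m′≤m = lower-bound x m
    in m′ , m′≤x ∷ All.map (≤-trans m′≤m) m≤xs

  -- Below some point, a polynomial of degree n has the sign of its leading
  -- coefficient times (-1)ⁿ. The constant κ stands for the sign of the leading
  -- coefficient; the bound ε away from zero serves the induction.
  sign-at-minus-infinity : ∀ n p κ → DegreeAtMost n p → 0# < κ * coeff p n →
    ∃[ M ] ∃[ ε ] 0# < ε × (∀ x → x < M → ε ≤ κ * (alternating n * eval p x))
  sign-at-minus-infinity zero p κ deg 0<κp₀ =
    0# , κ * coeff p 0 , 0<κp₀ , λ x _ → inj₂ (*-congˡ (sym (begin
      1# * eval p x             ≈⟨ *-identityˡ _ ⟩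
      eval p x                  ≈⟨ eval-cong p (coeff p 0 ∷ []) (degree-0 p deg) x ⟩
      eval (coeff p 0 ∷ []) x   ≈⟨ eval-const _ x ⟩
      coeff p 0                 ∎)))
    where open import Relation.Binary.Reasoning.Setoid setoid
  sign-at-minus-infinity (suc n) [] κ deg 0<κ0 = ⊥-elim (pos⇒≉0 0<κ0 (zeroʳ κ))
  sign-at-minus-infinity (suc n) (c ∷ p) κ deg 0<κpₙ =
    let M , ε , 0<ε , ε≤ = sign-at-minus-infinity n p κ (λ j n<j → deg (suc j) (s≤s n<j)) 0<κpₙ
        i    = ε ⁻¹
        t    = κ * (alternating n * c)
        M′ , M′≤M , M′≤0 = lower-bound M 0#
        M″ , M″≤M′ , M″≤ = lower-bound M′ (- ((t + 1#) * i))
    in M″ , 1# , 0<1 , λ x x<M″ →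
       let x<M′ = <-≤-trans x<M″ M″≤M′
       in inj₁ (beyond x ε t 0<ε (<-≤-trans x<M′ M′≤0) (ε≤ x (<-≤-trans x<M′ M′≤M))
                  (<-≤-trans x<M″ M″≤) (*-inverseʳ ε (pos⇒≉0 0<ε)) refl)
    where
    open import Relation.Binary.Reasoning.Setoid setoid
    -- Multiplying x < - (t + 1) / ε by ε turns it into - x ε > t + 1.
    beyond : ∀ x ε t {i} → 0# < ε → x < 0# → ε ≤ κ * (alternating n * eval p x) →
      x < - ((t + 1#) * i) → ε * i ≈ 1# → κ * (alternating n * c) ≈ t →
      1# < κ * (- alternating n * (c + x * eval p x))
    beyond x ε t {i} 0<ε x<0 ε≤ x<- inv t≈ = 0<-⇒< (<-respʳ-≈ (begin
      ((- ((t + 1#) * i)) - x) * ε + (- x) * (κ * (a * eval p x) - ε)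
        ≈⟨ solve 7 (λ t i x e k a v →
             ((:- ((t :+ :1) :* i)) :- x) :* e :+ (:- x) :* (k :* (a :* v) :- e)
               := k :* ((:- a) :* (x :* v)) :- (t :+ :1) :* (e :* i))
             refl t i x ε κ a (eval p x) ⟩
      κ * (- a * (x * eval p x)) - (t + 1#) * (ε * i)
        ≈⟨ +-congˡ (-‿cong (*-cong (+-congʳ (sym t≈)) inv)) ⟩
      κ * (- a * (x * eval p x)) - (κ * (a * c) + 1#) * 1#
        ≈⟨ solve 5 (λ x k a v c → k :* ((:- a) :* (x :* v)) :- (k :* (a :* c) :+ :1) :* :1
               := k :* ((:- a) :* (c :+ x :* v)) :- :1) refl x κ a (eval p x) c ⟩
      κ * (- a * (c + x * eval p x)) - 1# ∎)
      (<-≤-trans (*-pos (<⇒0<- x<-) 0<ε) (≤-+ˡ (*-nonneg (inj₁ (neg⇒0<- x<0)) (0≤- ε≤)))))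
      where
      a : Carrier
      a = alternating n
      0≤- : ∀ {x y} → x ≤ y → 0# ≤ y - x
      0≤- (inj₁ x<y) = inj₁ (<⇒0<- x<y)
      0≤- (inj₂ x≈y) = inj₂ (sym (trans (+-congˡ (-‿cong x≈y)) (-‿inverseʳ _)))
      ≤-+ˡ : ∀ {x y} → 0# ≤ y → x ≤ x + y
      ≤-+ˡ {x} (inj₁ 0<y) = inj₁ (<-respˡ-≈ (+-identityʳ x) (+-monoʳ-< x 0<y))
      ≤-+ˡ {x} (inj₂ 0≈y) = inj₂ (trans (sym (+-identityʳ x)) (+-congˡ 0≈y))

  -- Convolution and binomial series

  ⋆-congʳ : ∀ f {g h} → (∀ n → g n ≈ h n) → ∀ n → (f ⋆ g) n ≈ (f ⋆ h) n
  ⋆-congʳ f g≈h zero    = +-congʳ (*-congˡ (g≈h 0))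
  ⋆-congʳ f g≈h (suc n) = +-cong (*-congˡ (g≈h (suc n))) (⋆-congʳ (λ k → f (suc k)) g≈h n)

  []-⋆ : ∀ g n → (coeff [] ⋆ g) n ≈ 0#
  []-⋆ g zero    = trans (+-congʳ (zeroˡ _)) (+-identityʳ 0#)
  []-⋆ g (suc n) = trans (+-cong (zeroˡ _) ([]-⋆ g n)) (+-identityʳ 0#)

  const-+-⋆ : ∀ d p g n → (coeff ((d ∷ []) +ₚ p) ⋆ g) n ≈ d * g n + (coeff p ⋆ g) n
  const-+-⋆ d []      g zero    =
    solve 2 (λ d x → d :* x :+ :0 := d :* x :+ (:0 :* x :+ :0)) refl d (g 0)
  const-+-⋆ d []      g (suc n) =
    +-congˡ (sym (trans (+-congʳ (zeroˡ _)) (+-identityˡ _)))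
  const-+-⋆ d (c ∷ p) g zero    =
    solve 3 (λ d c x → (d :+ c) :* x :+ :0 := d :* x :+ (c :* x :+ :0)) refl d c (g 0)
  const-+-⋆ d (c ∷ p) g (suc n) =
    solve 4 (λ d c x y → (d :+ c) :* x :+ y := d :* x :+ (c :* x :+ y)) refl d c (g (suc n)) _

  -- A power series with nonzero constant term can be cancelled.
  ⋆-cancelʳ : ∀ {f h g} → g 0 ≉ 0# → (∀ n → (f ⋆ g) n ≈ (h ⋆ g) n) → ∀ n → f n ≈ h n
  ⋆-cancelʳ {f} {h} {g} g₀≉0 eq zero = -‿≈0 (*-≈0 g₀≉0 (begin
    g 0 * (f 0 - h 0)                   ≈⟨ solve 3 (λ g f h → g :* (f :- h) := (f :* g :+ :0) :- (h :* g :+ :0)) refl _ _ _ ⟩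
    (f 0 * g 0 + 0#) - (h 0 * g 0 + 0#) ≈⟨ +-congʳ (eq 0) ⟩
    (h 0 * g 0 + 0#) - (h 0 * g 0 + 0#) ≈⟨ -‿inverseʳ _ ⟩
    0#                                  ∎))
    where open import Relation.Binary.Reasoning.Setoid setoid
  ⋆-cancelʳ {f} {h} {g} g₀≉0 eq (suc n) = ⋆-cancelʳ {λ k → f (suc k)} {λ k → h (suc k)} g₀≉0 tails n
    where
    tails : ∀ n → ((λ k → f (suc k)) ⋆ g) n ≈ ((λ k → h (suc k)) ⋆ g) n
    tails n = begin
      tf                                   ≈⟨ solve 2 (λ x y → y := (x :+ y) :- x) refl (f 0 * g (suc n)) tf ⟩
      (f ⋆ g) (suc n) - f 0 * g (suc n)    ≈⟨ +-cong (eq (suc n)) (-‿cong (*-congʳ (⋆-cancelʳ {f} {h} {g} g₀≉0 eq 0))) ⟩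
      (h ⋆ g) (suc n) - h 0 * g (suc n)    ≈⟨ solve 2 (λ x y → y := (x :+ y) :- x) refl (h 0 * g (suc n)) th ⟨
      th                                   ∎
      where
      open import Relation.Binary.Reasoning.Setoid setoid
      tf th : Carrier
      tf = ((λ k → f (suc k)) ⋆ g) n
      th = ((λ k → h (suc k)) ⋆ g) n

  fromNat-suc-pos : ∀ n → 0# < fromNat (suc n)
  fromNat-suc-pos zero    = <-respʳ-≈ (sym (+-identityʳ 1#)) 0<1
  fromNat-suc-pos (suc n) = +-pos 0<1 (fromNat-suc-pos n)

  fromNat-+ : ∀ m n → fromNat (m ℕ.+ n) ≈ fromNat m + fromNat n
  fromNat-+ = SemiringMult.×-homo-+ semiring 1#

  fromNat-! : ∀ n → fromNat (suc n !) ≈ fromNat (suc n) * fromNat (n !)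
  fromNat-! n = SemiringMult.×1-homo-* semiring (suc n) (n !)

  fromNat-!-pos : ∀ n → 0# < fromNat (n !)
  fromNat-!-pos zero    = fromNat-suc-pos 0
  fromNat-!-pos (suc n) = <-respʳ-≈ (sym (fromNat-! n)) (*-pos (fromNat-suc-pos n) (fromNat-!-pos n))

  suc-*-!⁻¹ : ∀ n → fromNat (suc n) * fromNat (suc n !) ⁻¹ ≈ fromNat (n !) ⁻¹
  suc-*-!⁻¹ n = begin
    S * M ⁻¹                 ≈⟨ *-identityʳ _ ⟨
    S * M ⁻¹ * 1#            ≈⟨ *-congˡ (*-inverseʳ N (pos⇒≉0 (fromNat-!-pos n))) ⟨
    S * M ⁻¹ * (N * N ⁻¹)    ≈⟨ solve 4 (λ S m N i → S :* m :* (N :* i) := (S :* N) :* m :* i) refl S (M ⁻¹) N (N ⁻¹) ⟩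
    (S * N) * M ⁻¹ * N ⁻¹    ≈⟨ *-congʳ (*-congʳ (sym (fromNat-! n))) ⟩
    M * M ⁻¹ * N ⁻¹          ≈⟨ *-congʳ (*-inverseʳ M (pos⇒≉0 (fromNat-!-pos (suc n)))) ⟩
    1# * N ⁻¹                ≈⟨ *-identityˡ _ ⟩
    N ⁻¹                     ∎
    where
    open import Relation.Binary.Reasoning.Setoid setoid
    S N M : Carrier
    S = fromNat (suc n)
    N = fromNat (n !)
    M = fromNat (suc n !)

  pochhammer-cong : ∀ {a b} → a ≈ b → ∀ n → pochhammer a n ≈ pochhammer b n
  pochhammer-cong a≈b zero    = refl
  pochhammer-cong a≈b (suc n) = *-cong (pochhammer-cong a≈b n) (+-congʳ a≈b)

  pochhammer-suc : ∀ b n → pochhammer b (suc n) ≈ b * pochhammer (b + 1#) n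
  pochhammer-suc b zero    = solve 1 (λ b → :1 :* (b :+ :0) := b :* :1) refl b
  pochhammer-suc b (suc n) = trans (*-congʳ (pochhammer-suc b n))
    (solve 3 (λ b p f → (b :* p) :* (b :+ (:1 :+ f)) := b :* (p :* ((b :+ :1) :+ f)))
       refl b (pochhammer (b + 1#) n) (fromNat n))

  binomialSeries-cong : ∀ {a b} → a ≈ b → ∀ n → binomialSeries a n ≈ binomialSeries b n
  binomialSeries-cong a≈b n = *-congʳ (pochhammer-cong a≈b n)

  binomialSeries-0 : ∀ b → binomialSeries b 0 ≉ 0#
  binomialSeries-0 b = *-≉0 (pos⇒≉0 0<1) (pos⇒≉0 (⁻¹-pos (fromNat-!-pos 0)))

  -- The derivative of (1-x)^(-b) is b (1-x)^(-b-1).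
  binomialSeries-derivative : ∀ b n →
    fromNat (suc n) * binomialSeries b (suc n) ≈ b * binomialSeries (b + 1#) n
  binomialSeries-derivative b n = begin
    S * (pochhammer b (suc n) * M ⁻¹)            ≈⟨ *-congˡ (*-congʳ (pochhammer-suc b n)) ⟩
    S * (b * pochhammer (b + 1#) n * M ⁻¹)       ≈⟨ solve 4 (λ S b p m → S :* (b :* p :* m) := b :* (p :* (S :* m))) refl S b _ _ ⟩
    b * (pochhammer (b + 1#) n * (S * M ⁻¹))     ≈⟨ *-congˡ (*-congˡ (suc-*-!⁻¹ n)) ⟩
    b * binomialSeries (b + 1#) n                ∎
    where
    open import Relation.Binary.Reasoning.Setoid setoid
    S M : Carrier
    S = fromNat (suc n)
    M = fromNat (suc n !)

  -- (1-x)^(-b) = (1-x) (1-x)^(-b-1).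
  binomialSeries-difference : ∀ b n →
    binomialSeries b (suc n) ≈ binomialSeries (b + 1#) (suc n) - binomialSeries (b + 1#) n
  binomialSeries-difference b n = begin
    pochhammer b (suc n) * M ⁻¹      ≈⟨ *-congʳ (pochhammer-suc b n) ⟩
    b * P * M ⁻¹
      ≈⟨ solve 4 (λ b p f m → b :* p :* m := p :* ((b :+ :1) :+ f) :* m :- p :* ((:1 :+ f) :* m)) refl b P (fromNat n) (M ⁻¹) ⟩
    binomialSeries (b + 1#) (suc n) - P * (fromNat (suc n) * M ⁻¹)
      ≈⟨ +-congˡ (-‿cong (*-congˡ (suc-*-!⁻¹ n))) ⟩
    binomialSeries (b + 1#) (suc n) - binomialSeries (b + 1#) n ∎
    where
    open import Relation.Binary.Reasoning.Setoid setoid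
    P M : Carrier
    P = pochhammer (b + 1#) n
    M = fromNat (suc n !)

  -- Adding a zero to F

  -- The polynomial (α (1-x) + b x) p + x (1-x) p′, which is the numerator of
  -- (α + x d/dx) applied to p / (1-x)^b over the denominator (1-x)^(b+1).
  addZero : (α b : Carrier) → Poly → Poly
  addZero α b []      = []
  addZero α b (c ∷ p) = α * c ∷ (((b - α) * c ∷ []) +ₚ addZero (α + 1#) b p)

  addZero-coeff-zero : ∀ α b p → coeff (addZero α b p) 0 ≈ α * coeff p 0
  addZero-coeff-zero α b []      = sym (zeroʳ α)
  addZero-coeff-zero α b (c ∷ p) = refl

  addZero-coeff-suc : ∀ α b p n → coeff (addZero α b p) (suc n) ≈
    (α + fromNat (suc n)) * coeff p (suc n) + (b - α - fromNat n) * coeff p n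
  addZero-coeff-suc α b [] n =
    solve 2 (λ s t → :0 := s :* :0 :+ t :* :0) refl (α + fromNat (suc n)) (b - α - fromNat n)
  addZero-coeff-suc α b (c ∷ p) zero = begin
    coeff (((b - α) * c ∷ []) +ₚ addZero (α + 1#) b p) 0
      ≈⟨ coeff-+ₚ ((b - α) * c ∷ []) (addZero (α + 1#) b p) 0 ⟩
    (b - α) * c + coeff (addZero (α + 1#) b p) 0
      ≈⟨ +-congˡ (addZero-coeff-zero (α + 1#) b p) ⟩
    (b - α) * c + (α + 1#) * coeff p 0
      ≈⟨ solve 4 (λ α b c d → (b :- α) :* c :+ (α :+ :1) :* d
                              := (α :+ (:1 :+ :0)) :* d :+ (b :- α :- :0) :* c)
           refl α b c (coeff p 0) ⟩
    (α + fromNat 1) * coeff p 0 + (b - α - fromNat 0) * c ∎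
    where open import Relation.Binary.Reasoning.Setoid setoid
  addZero-coeff-suc α b (c ∷ p) (suc n) = begin
    coeff (((b - α) * c ∷ []) +ₚ addZero (α + 1#) b p) (suc n)
      ≈⟨ coeff-+ₚ ((b - α) * c ∷ []) (addZero (α + 1#) b p) (suc n) ⟩
    0# + coeff (addZero (α + 1#) b p) (suc n)
      ≈⟨ +-congˡ (addZero-coeff-suc (α + 1#) b p n) ⟩
    0# + (((α + 1#) + fromNat (suc n)) * coeff p (suc n) + (b - (α + 1#) - fromNat n) * coeff p n)
      ≈⟨ solve 5 (λ α b f d e →
           :0 :+ (((α :+ :1) :+ (:1 :+ f)) :* d :+ (b :- (α :+ :1) :- f) :* e)
             := (α :+ (:1 :+ (:1 :+ f))) :* d :+ (b :- α :- (:1 :+ f)) :* e)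
           refl α b (fromNat n) (coeff p (suc n)) (coeff p n) ⟩
    (α + fromNat (suc (suc n))) * coeff p (suc n) + (b - α - fromNat (suc n)) * coeff p n ∎
    where open import Relation.Binary.Reasoning.Setoid setoid

  addZero-eval : ∀ α b p x → eval (addZero α b p) x ≈
    (α * (1# - x) + b * x) * eval p x + x * (1# - x) * evalD p x
  addZero-eval α b []      x =
    solve 2 (λ s t → :0 := s :* :0 :+ t :* :0) refl (α * (1# - x) + b * x) (x * (1# - x))
  addZero-eval α b (c ∷ p) x = begin
    α * c + x * eval (((b - α) * c ∷ []) +ₚ addZero (α + 1#) b p) x
      ≈⟨ +-congˡ (*-congˡ (eval-+ ((b - α) * c ∷ []) (addZero (α + 1#) b p) x)) ⟩
    α * c + x * (eval ((b - α) * c ∷ []) x + eval (addZero (α + 1#) b p) x)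
      ≈⟨ +-congˡ (*-congˡ (+-cong (eval-const _ x) (addZero-eval (α + 1#) b p x))) ⟩
    α * c + x * ((b - α) * c +
      (((α + 1#) * (1# - x) + b * x) * eval p x + x * (1# - x) * evalD p x))
      ≈⟨ solve 6 (λ α b c x v d →
           α :* c :+ x :* ((b :- α) :* c :+
             (((α :+ :1) :* (:1 :- x) :+ b :* x) :* v :+ x :* (:1 :- x) :* d))
           := (α :* (:1 :- x) :+ b :* x) :* (c :+ x :* v) :+ x :* (:1 :- x) :* (v :+ x :* d))
           refl α b c x (eval p x) (evalD p x) ⟩
    (α * (1# - x) + b * x) * (c + x * eval p x) + x * (1# - x) * (eval p x + x * evalD p x)
      ≈⟨ +-congˡ (*-congˡ (evalD-∷ c p x)) ⟨
    (α * (1# - x) + b * x) * eval (c ∷ p) x + x * (1# - x) * evalD (c ∷ p) x ∎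
    where open import Relation.Binary.Reasoning.Setoid setoid

  -- Multiplying the n-th coefficient of p / (1-x)^b by α + n replaces p by
  -- addZero α b p and b by b + 1.
  addZero-⋆ : ∀ b α p n →
    (coeff (addZero α b p) ⋆ binomialSeries (b + 1#)) n
      ≈ (α + fromNat n) * (coeff p ⋆ binomialSeries b) n
  addZero-⋆ b α []      n    =
    trans ([]-⋆ (binomialSeries (b + 1#)) n)
      (sym (trans (*-congˡ ([]-⋆ (binomialSeries b) n)) (zeroʳ _)))
  addZero-⋆ b α (c ∷ p) zero =
    solve 3 (λ α c x → (α :* c) :* x :+ :0 := (α :+ :0) :* (c :* x :+ :0)) refl α c (binomialSeries b 0)
  addZero-⋆ b α (c ∷ p) (suc n) = begin
    (α * c) * B′ (suc n) + (coeff (((b - α) * c ∷ []) +ₚ addZero (α + 1#) b p) ⋆ B′) n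
      ≈⟨ +-congˡ (const-+-⋆ ((b - α) * c) (addZero (α + 1#) b p) B′ n) ⟩
    (α * c) * B′ (suc n) + ((b - α) * c * B′ n + (coeff (addZero (α + 1#) b p) ⋆ B′) n)
      ≈⟨ +-congˡ (+-congˡ (addZero-⋆ b (α + 1#) p n)) ⟩
    (α * c) * B′ (suc n) + ((b - α) * c * B′ n + ((α + 1#) + f) * C)
      ≈⟨ solve 7 (λ α b c x y f C →
           (α :* c) :* x :+ ((b :- α) :* c :* y :+ ((α :+ :1) :+ f) :* C)
             := α :* c :* (x :- y) :+ c :* (b :* y) :+ (α :+ (:1 :+ f)) :* C)
           refl α b c (B′ (suc n)) (B′ n) f C ⟩
    α * c * (B′ (suc n) - B′ n) + c * (b * B′ n) + (α + (1# + f)) * C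
      ≈⟨ +-congʳ (+-cong (*-congˡ (binomialSeries-difference b n)) (*-congˡ (binomialSeries-derivative b n))) ⟨
    α * c * B (suc n) + c * ((1# + f) * B (suc n)) + (α + (1# + f)) * C
      ≈⟨ solve 5 (λ α c x f C → α :* c :* x :+ c :* ((:1 :+ f) :* x) :+ (α :+ (:1 :+ f)) :* C
                   := (α :+ (:1 :+ f)) :* (c :* x :+ C)) refl α c (B (suc n)) f C ⟩
    (α + (1# + f)) * (c * B (suc n) + C) ∎
    where
    open import Relation.Binary.Reasoning.Setoid setoid
    B B′ : PowerSeries
    B  = binomialSeries b
    B′ = binomialSeries (b + 1#)
    f C : Carrier
    f = fromNat n
    C = (coeff p ⋆ B) n

  -- Eulerian polynomials of products

  -- The product of the α i + x; the recursion splits off the last factor, since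
  -- the zeros are added in increasing order.
  shifted∏ : ∀ m → (Fin m → Carrier) → Carrier → Carrier
  shifted∏ zero    α x = 1#
  shifted∏ (suc m) α x = (α (fromℕ m) + x) * shifted∏ m (λ i → α (inject₁ i)) x

  -- The Eulerian polynomial of e · shifted∏ m α, a product of m linear factors.
  eulerian : (a e : Carrier) → ∀ m → (Fin m → Carrier) → Poly
  eulerian a e zero    α = e ∷ []
  eulerian a e (suc m) α = addZero (α (fromℕ m)) (fromNat m + a) (eulerian a e m (λ i → α (inject₁ i)))

  eulerian-⋆ : ∀ a e m α n →
    e * shifted∏ m α (fromNat n) * binomialSeries a n
      ≈ (coeff (eulerian a e m α) ⋆ binomialSeries (fromNat m + a)) n
  eulerian-⋆ a e zero α n = sym (begin
    (coeff (e ∷ []) ⋆ binomialSeries (0# + a)) n    ≈⟨ ⋆-congʳ (coeff (e ∷ [])) (binomialSeries-cong (+-identityˡ a)) n ⟩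
    (coeff (e ∷ []) ⋆ binomialSeries a) n           ≈⟨ const-+-⋆ e [] (binomialSeries a) n ⟩
    e * binomialSeries a n + (coeff [] ⋆ binomialSeries a) n ≈⟨ +-congˡ ([]-⋆ (binomialSeries a) n) ⟩
    e * binomialSeries a n + 0#                     ≈⟨ solve 2 (λ e x → e :* x :+ :0 := e :* :1 :* x) refl e _ ⟩
    e * 1# * binomialSeries a n                     ∎)
    where open import Relation.Binary.Reasoning.Setoid setoid
  eulerian-⋆ a e (suc m) α n = sym (begin
    (coeff p′ ⋆ binomialSeries ((1# + fromNat m) + a)) n
      ≈⟨ ⋆-congʳ (coeff p′) (binomialSeries-cong (solve 2 (λ f a → (:1 :+ f) :+ a := (f :+ a) :+ :1) refl (fromNat m) a)) n ⟩
    (coeff p′ ⋆ binomialSeries ((fromNat m + a) + 1#)) n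
      ≈⟨ addZero-⋆ (fromNat m + a) (α (fromℕ m)) p n ⟩
    (α (fromℕ m) + fromNat n) * (coeff p ⋆ binomialSeries (fromNat m + a)) n
      ≈⟨ *-congˡ (eulerian-⋆ a e m (λ i → α (inject₁ i)) n) ⟨
    (α (fromℕ m) + fromNat n) * (e * shifted∏ m (λ i → α (inject₁ i)) (fromNat n) * binomialSeries a n)
      ≈⟨ solve 4 (λ s e t x → s :* (e :* t :* x) := e :* (s :* t) :* x) refl _ e _ _ ⟩
    e * shifted∏ (suc m) α (fromNat n) * binomialSeries a n ∎)
    where
    open import Relation.Binary.Reasoning.Setoid setoid
    p p′ : Poly
    p  = eulerian a e m (λ i → α (inject₁ i))
    p′ = eulerian a e (suc m) α

  shifted∏-head : ∀ m α x →
    shifted∏ (suc m) α x ≈ (α Fin.zero + x) * shifted∏ m (λ i → α (Fin.suc i)) x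
  shifted∏-head zero    α x = refl
  shifted∏-head (suc m) α x = trans (*-congˡ (shifted∏-head m (λ i → α (inject₁ i)) x))
    (solve 3 (λ s t u → s :* (t :* u) := t :* (s :* u)) refl _ _ _)

  eval-neg : ∀ p x → eval (map -_ p) x ≈ - eval p x
  eval-neg []      x = solve 0 (:0 := :- :0) refl
  eval-neg (c ∷ p) x = trans (+-congˡ (*-congˡ (eval-neg p x)))
    (solve 3 (λ c x v → (:- c) :+ x :* (:- v) := :- (c :+ x :* v)) refl c x (eval p x))

  eval-reflect : ∀ p x → eval p x ≈ eval (reflect p) (- x)
  eval-reflect []      x = refl
  eval-reflect (c ∷ p) x = +-congˡ (begin
    x * eval p x                                ≈⟨ *-congˡ (eval-reflect p x) ⟩
    x * eval (reflect p) (- x)                  ≈⟨ solve 2 (λ x v → x :* v := (:- x) :* (:- v)) refl x _ ⟩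
    - x * - eval (reflect p) (- x)              ≈⟨ *-congˡ (eval-neg (reflect p) (- x)) ⟨
    - x * eval (map -_ (reflect p)) (- x)       ∎)
    where open import Relation.Binary.Reasoning.Setoid setoid

  eval-product : ∀ m (α : Fin m → Carrier) x →
    eval (Vector.foldr _*ₚ_ (1# ∷ []) (λ i → X- (α i))) (- x) ≈ alternating m * shifted∏ m α x
  eval-product zero    α x = trans (eval-const 1# (- x)) (sym (*-identityˡ 1#))
  eval-product (suc m) α x = begin
    eval ((X- (α Fin.zero)) *ₚ P) (- x)                     ≈⟨ eval-* (X- (α Fin.zero)) P (- x) ⟩
    eval (X- (α Fin.zero)) (- x) * eval P (- x)
      ≈⟨ *-cong (eval-X- (α Fin.zero) (- x)) (eval-product m (λ i → α (Fin.suc i)) x) ⟩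
    (- x - α Fin.zero) * (alternating m * shifted∏ m (λ i → α (Fin.suc i)) x)
      ≈⟨ solve 4 (λ x r s t → ((:- x) :- r) :* (s :* t) := (:- s) :* ((r :+ x) :* t)) refl x _ _ _ ⟩
    alternating (suc m) * ((α Fin.zero + x) * shifted∏ m (λ i → α (Fin.suc i)) x)
      ≈⟨ *-congˡ (shifted∏-head m α x) ⟨
    alternating (suc m) * shifted∏ (suc m) α x              ∎
    where
    open import Relation.Binary.Reasoning.Setoid setoid
    P : Poly
    P = Vector.foldr _*ₚ_ (1# ∷ []) (λ i → X- (α (Fin.suc i)))

  eval-from-zeros : ∀ {m} F (α : Fin m → Carrier) → ZerosWithMultiplicity (reflect F) α →
    ∃[ e ] (∀ x → eval F x ≈ e * shifted∏ m α x)
  eval-from-zeros {m} F α (c , _ , F≈) = c * alternating m , λ x → begin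
    eval F x                                ≈⟨ eval-reflect F x ⟩
    eval (reflect F) (- x)                  ≈⟨ eval-cong (reflect F) ((c ∷ []) *ₚ P) F≈ (- x) ⟩
    eval ((c ∷ []) *ₚ P) (- x)              ≈⟨ eval-* (c ∷ []) P (- x) ⟩
    eval (c ∷ []) (- x) * eval P (- x)      ≈⟨ *-cong (eval-const c (- x)) (eval-product m α x) ⟩
    c * (alternating m * shifted∏ m α x)    ≈⟨ *-assoc _ _ _ ⟨
    c * alternating m * shifted∏ m α x      ∎
    where
    open import Relation.Binary.Reasoning.Setoid setoid
    P : Poly
    P = Vector.foldr _*ₚ_ (1# ∷ []) (λ i → X- (α i))

  eulerian-unique : ∀ {a m} F (α : Fin m → Carrier) w e →
    (∀ x → eval F x ≈ e * shifted∏ m α x) → IsEulerianPolynomial a m F w →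
    w ≈ₚ eulerian a e m α
  eulerian-unique {a} {m} F α w e F≈ (_ , series) =
    ⋆-cancelʳ {g = binomialSeries (fromNat m + a)} (binomialSeries-0 (fromNat m + a)) λ n →
      trans (sym (series n)) (trans (*-congʳ (F≈ (fromNat n))) (eulerian-⋆ a e m α n))

  -- One more zero: the interlacing step

  -- p is a constant multiple of a product of d distinct factors X - r with r < 0.
  -- The roots are listed in increasing order.
  NegativeZeros : ℕ → Poly → Set
  NegativeZeros d p = ∃[ rs ] length rs ≡.≡ d × AllPairs _<_ rs × All (_< 0#) rs ×
                      ∃[ c ] p ≈ₚ withRoots rs (c ∷ [])

  -- As many roots as the degree allows are all the zeros.
  all-negative-zeros : ∀ {d} u ss → length ss ≡.≡ d → AllPairs _<_ ss → All (_< 0#) ss →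
    All (λ s → eval u s ≈ 0#) ss → DegreeAtMost d u → NegativeZeros d u
  all-negative-zeros u ss ≡.refl sorted ss<0 roots deg =
    let q , deg-q , u≈ = factor-roots ss 0 u sorted roots
          (≡.subst (λ d → DegreeAtMost d u) (≡.sym (ℕ.+-identityʳ (length ss))) deg)
    in ss , ≡.refl , sorted , ss<0 , coeff q 0 ,
       λ n → trans (u≈ n) (withRoots-cong ss q (coeff q 0 ∷ []) (degree-0 q deg-q) n)

  const-degree : ∀ c → DegreeAtMost 0 (c ∷ [])
  const-degree c (suc n) _ = refl

  -- The passage from v, with the distinct negative roots rs, to u.
  module Step (rs : List Carrier) (sorted : AllPairs _<_ rs) (rs<0 : All (_< 0#) rs)
    (c : Carrier) (v : Poly) (v≈ : v ≈ₚ withRoots rs (c ∷ [])) (c≉0 : c ≉ 0#)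
    (α b : Carrier) where

    d : ℕ
    d = length rs

    u : Poly
    u = addZero α b v

    -- The coefficient of u at X^(d+1) is lead · c.
    lead : Carrier
    lead = b - α - fromNat d

    v-degree : DegreeAtMost d v
    v-degree n d<n = trans (v≈ n)
      (withRoots-degree rs (const-degree c) n (≡.subst (ℕ._< n) (≡.sym (ℕ.+-identityʳ d)) d<n))

    v-leading : coeff v d ≈ c
    v-leading = trans (v≈ d) (≡.subst (λ n → coeff (withRoots rs (c ∷ [])) n ≈ c)
      (ℕ.+-identityʳ d) (withRoots-leading rs (const-degree c)))

    v-eval : ∀ x → eval v x ≈ ∏ rs x * c
    v-eval x = trans (eval-cong v (withRoots rs (c ∷ [])) v≈ x)
      (trans (eval-withRoots rs (c ∷ []) x) (*-congˡ (eval-const c x)))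

    v-evalD : ∀ x → evalD v x ≈ ∏′ rs x * c
    v-evalD x = trans (evalD-cong v (withRoots rs (c ∷ [])) v≈ x) (trans (evalD-withRoots rs (c ∷ []) x)
      (trans (+-congʳ (*-congˡ (eval-const c x)))
        (solve 4 (λ s c t x → s :* c :+ t :* (x :* :0 :+ :1 :* :0) := s :* c) refl _ c (∏ rs x) x)))

    u-degree : DegreeAtMost (suc d) u
    u-degree (suc n) (s≤s d<n) = trans (addZero-coeff-suc α b v n)
      (trans (+-cong (*-congˡ (v-degree (suc n) (ℕ.m<n⇒m<1+n d<n))) (*-congˡ (v-degree n d<n)))
        (solve 2 (λ s t → s :* :0 :+ t :* :0 := :0) refl _ _))

    u-leading : coeff u (suc d) ≈ lead * c
    u-leading = trans (addZero-coeff-suc α b v d)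
      (trans (+-cong (*-congˡ (v-degree (suc d) ℕ.≤-refl)) (*-congˡ v-leading))
        (trans (+-congʳ (zeroʳ _)) (+-identityˡ _)))

    u-0 : eval u 0# ≈ α * (∏ rs 0# * c)
    u-0 = trans (eval-0 u) (trans (addZero-coeff-zero α b v)
      (*-congˡ (trans (sym (eval-0 v)) (v-eval 0#))))

    -- At a root of v only the term containing the derivative survives.
    u-root : ∀ {t} → ∏ rs t ≈ 0# → eval u t ≈ t * (1# - t) * (∏′ rs t * c)
    u-root {t} root = begin
      eval u t   ≈⟨ addZero-eval α b v t ⟩
      (α * (1# - t) + b * t) * eval v t + t * (1# - t) * evalD v t
        ≈⟨ +-cong (*-congˡ (trans (v-eval t) (trans (*-congʳ root) (zeroˡ c)))) (*-congˡ (v-evalD t)) ⟩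
      (α * (1# - t) + b * t) * 0# + t * (1# - t) * (∏′ rs t * c)
        ≈⟨ trans (+-congʳ (zeroʳ _)) (+-identityˡ _) ⟩
      t * (1# - t) * (∏′ rs t * c) ∎
      where open import Relation.Binary.Reasoning.Setoid setoid

    0<1- : ∀ {t} → t < 0# → 0# < 1# - t
    0<1- t<0 = +-pos 0<1 (neg⇒0<- t<0)

    -- The point 0 is added to the roots of v in order to catch the root of u
    -- between the largest of them and 0.
    module _ (0<α : 0# < α) where

      points : List Carrier
      points = rs ∷ʳ 0#

      points-sorted : AllPairs _<_ points
      points-sorted = AllPairs.++⁺ sorted ([] ∷ []) (All.map (λ r<0 → r<0 ∷ []) rs<0)

      points≤0 : All (_≤ 0#) points
      points≤0 = All.∷ʳ⁺ (All.map inj₁ rs<0) (inj₂ refl)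

      signs : All (λ t → 0# < c * (eval u t * ∏′ points t)) points
      signs = All.∷ʳ⁺
        (All.zipWith (λ {t} (root , t<0 , simple) → sign-root root t<0 simple)
          (∏-root rs , All.zip (rs<0 , ∏′-≉0 sorted)))
        (<-respʳ-≈ (sym (begin
          c * (eval u 0# * ∏′ points 0#)
            ≈⟨ *-congˡ (*-cong u-0 (∏′-∷ʳ rs 0# 0#)) ⟩
          c * (α * (∏ rs 0# * c) * (∏′ rs 0# * (0# - 0#) + ∏ rs 0#))
            ≈⟨ solve 4 (λ c a p p′ → c :* (a :* (p :* c) :* (p′ :* (:0 :- :0) :+ p)) := a :* ((p :* c) :* (p :* c)))
                 refl c α (∏ rs 0#) (∏′ rs 0#) ⟩
          α * ((∏ rs 0# * c) * (∏ rs 0# * c)) ∎))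
          (*-pos 0<α (square-pos (*-≉0 (pos⇒≉0 (∏-pos rs<0)) c≉0))))
        where
        open import Relation.Binary.Reasoning.Setoid setoid
        sign-root : ∀ {t} → ∏ rs t ≈ 0# → t < 0# → ∏′ rs t ≉ 0# →
          0# < c * (eval u t * ∏′ points t)
        sign-root {t} root t<0 simple = <-respʳ-≈ (sym (begin
          c * (eval u t * ∏′ points t)
            ≈⟨ *-congˡ (*-cong (u-root root) (trans (∏′-∷ʳ rs 0# t) (+-congˡ root))) ⟩
          c * (t * (1# - t) * (∏′ rs t * c) * (∏′ rs t * (t - 0#) + 0#))
            ≈⟨ solve 3 (λ c t p → c :* (t :* (:1 :- t) :* (p :* c) :* (p :* (t :- :0) :+ :0))
                 := (t :* t) :* (:1 :- t) :* ((p :* c) :* (p :* c))) refl c t (∏′ rs t) ⟩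
          (t * t) * (1# - t) * ((∏′ rs t * c) * (∏′ rs t * c)) ∎))
          (*-pos (*-pos (square-pos (neg⇒≉0 t<0)) (0<1- t<0)) (square-pos (*-≉0 simple c≉0)))

      degenerate-step : lead ≈ 0# → NegativeZeros d u
      degenerate-step lead≈0 =
        let ss , length≡ , sorted-ss , ss<0 , roots = interlace c u points points-sorted points≤0 signs
        in all-negative-zeros u ss (≡.trans length≡ (≡.cong ℕ.pred (length-∷ʳ rs))) sorted-ss ss<0 roots u-degree′
        where
        length-∷ʳ : ∀ xs → length (xs ∷ʳ 0#) ≡.≡ suc (length xs)
        length-∷ʳ xs = ≡.trans (List.length-++ xs) (ℕ.+-comm (length xs) 1)
        u-degree′ : DegreeAtMost d u
        u-degree′ n d<n with ℕ.m≤n⇒m<n∨m≡n d<n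
        ... | inj₁ 1+d<n = u-degree n 1+d<n
        ... | inj₂ ≡.refl = trans u-leading (trans (*-congʳ lead≈0) (zeroˡ c))

      -- When u has larger degree than v it also changes sign to the left of all
      -- roots of v: near minus infinity u and v have opposite signs.
      opposite-signs : 0# < lead → ∃[ M ] M < 0# × All (M <_) rs × eval u M * eval v M < 0#
      opposite-signs 0<lead =
        let M₁ , ε₁ , 0<ε₁ , v-sign = sign-at-minus-infinity d v c v-degree
              (<-respʳ-≈ (*-congˡ (sym v-leading)) (square-pos c≉0))
            M₂ , ε₂ , 0<ε₂ , u-sign = sign-at-minus-infinity (suc d) u c u-degree
              (<-respʳ-≈ (trans (solve 2 (λ l c → l :* (c :* c) := c :* (l :* c)) refl lead c)
                (*-congˡ (sym u-leading))) (*-pos 0<lead (square-pos c≉0)))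
            m , m≤ = list-lower-bound (M₁ ∷ M₂ ∷ 0# ∷ rs)
            M = m - 1#
            <M : ∀ {x} → m ≤ x → M < x
            <M = <-≤-trans (strict-lower-bound m)
        in M , <M (All.head (All.tail (All.tail m≤))) ,
           All.map <M (All.tail (All.tail (All.tail m≤))) ,
           opposite M (<-≤-trans 0<ε₁ (v-sign M (<M (All.head m≤))))
                      (<-≤-trans 0<ε₂ (u-sign M (<M (All.head (All.tail m≤)))))
        where
        opposite : ∀ M → 0# < c * (alternating d * eval v M) →
          0# < c * (- alternating d * eval u M) → eval u M * eval v M < 0#
        opposite M 0<v 0<u = 0<-⇒neg (*-pos-cancelʳ (square-nonneg (c * alternating d))
          (<-respʳ-≈ (solve 4 (λ c s v u → (c :* (s :* v)) :* (c :* ((:- s) :* u))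
                        := (:- (u :* v)) :* ((c :* s) :* (c :* s)))
                       refl c (alternating d) (eval v M) (eval u M))
            (*-pos 0<v 0<u)))

      regular-step : 0# < lead → NegativeZeros (suc d) u
      regular-step 0<lead =
        let M , M<0 , M<rs , opposite = opposite-signs 0<lead
            M<points = All.∷ʳ⁺ M<rs M<0
            ss , length≡ , sorted-ss , ss<0 , roots = interlace c u (M ∷ points)
              (M<points ∷ points-sorted) (inj₁ M<0 ∷ points≤0)
              (sign-M M M<0 opposite ∷
               All.zipWith (λ {t} (root , M<t , sign) → sign-point M root M<t sign)
                 (∏-root points , All.zip (M<points , signs)))
        in all-negative-zeros u ss (≡.trans length≡ (≡.trans (List.length-++ rs) (ℕ.+-comm d 1)))
             sorted-ss ss<0 roots u-degree
        where
        sign-M : ∀ M → M < 0# → eval u M * eval v M < 0# → 0# < c * (eval u M * ∏′ (M ∷ points) M)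
        sign-M M M<0 opposite = <-respʳ-≈
          (trans (*-congʳ (*-congˡ (v-eval M)))
            (trans (solve 4 (λ c u p M → (u :* (p :* c)) :* M := c :* (u :* (p :* (M :- :0))))
                      refl c (eval u M) (∏ rs M) M)
              (*-congˡ (*-congˡ (sym (trans (∏′-head M points) (∏-∷ʳ rs 0# M)))))))
          (neg*neg opposite M<0)
        sign-point : ∀ M {t} → ∏ points t ≈ 0# → M < t → 0# < c * (eval u t * ∏′ points t) →
          0# < c * (eval u t * ∏′ (M ∷ points) t)
        sign-point M {t} root M<t sign = <-respʳ-≈
          (trans (solve 4 (λ c u w p → (c :* (u :* p)) :* w := c :* (u :* (w :* p)))
                    refl c (eval u t) (t - M) (∏′ points t))
            (*-congˡ (*-congˡ (sym (∏′-tail M points root)))))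
          (*-pos sign (<⇒0<- M<t))

    -- The roots of u between those of v leave a factor q of degree at most 2. Its
    -- constant and quadratic coefficients are, up to positive factors, α c and
    -- lead · c, or the latter vanishes.
    indefinite-step : α * lead < 0# →
      ∃[ ss ] ∃[ q ] u ≈ₚ withRoots ss q × All (_< 0#) ss × DegreeAtMost 2 q ×
                     coeff q 0 ≉ 0# × coeff q 0 * coeff q 2 ≤ 0#
    indefinite-step αlead<0 = from-roots rs ≡.refl (interlace (- c) u rs sorted (All.map inj₁ rs<0)
      (All.zipWith (λ {t} (root , t<0 , simple) → sign-root root t<0 simple)
        (∏-root rs , All.zip (rs<0 , ∏′-≉0 sorted))))
      where
      open import Relation.Binary.Reasoning.Setoid setoid
      sign-root : ∀ {t} → ∏ rs t ≈ 0# → t < 0# → ∏′ rs t ≉ 0# → 0# < - c * (eval u t * ∏′ rs t)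
      sign-root {t} root t<0 simple = <-respʳ-≈ (sym (begin
        - c * (eval u t * ∏′ rs t)   ≈⟨ *-congˡ (*-congʳ (u-root root)) ⟩
        - c * (t * (1# - t) * (∏′ rs t * c) * ∏′ rs t)
          ≈⟨ solve 3 (λ c t p → (:- c) :* (t :* (:1 :- t) :* (p :* c) :* p)
                       := (:- t) :* (:1 :- t) :* ((p :* c) :* (p :* c))) refl c t (∏′ rs t) ⟩
        - t * (1# - t) * ((∏′ rs t * c) * (∏′ rs t * c)) ∎))
        (*-pos (*-pos (neg⇒0<- t<0) (0<1- t<0)) (square-pos (*-≉0 simple c≉0)))

      u-0≉0 : eval u 0# ≉ 0#
      u-0≉0 h = *-≉0 (*-≉0⇒ˡ (neg⇒≉0 αlead<0)) (*-≉0 (pos⇒≉0 (∏-pos rs<0)) c≉0) (trans (sym u-0) h)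

      -- If v is constant then the degree of u is at most 1 and q is u itself.
      from-roots : ∀ rs′ → rs′ ≡.≡ rs →
        ∃[ ss ] length ss ≡.≡ ℕ.pred (length rs′) × AllPairs _<_ ss × All (_< 0#) ss ×
                All (λ s → eval u s ≈ 0#) ss →
        ∃[ ss ] ∃[ q ] u ≈ₚ withRoots ss q × All (_< 0#) ss × DegreeAtMost 2 q ×
                       coeff q 0 ≉ 0# × coeff q 0 * coeff q 2 ≤ 0#
      from-roots [] ≡.refl _ =
        [] , u , (λ _ → refl) , [] , (λ n 2<n → u-degree n (ℕ.<-trans (s≤s (s≤s z≤n)) 2<n)) ,
        (λ h → u-0≉0 (trans (eval-0 u) h)) ,
        inj₂ (trans (*-congˡ (u-degree 2 (s≤s (s≤s z≤n)))) (zeroʳ _))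
      from-roots (_ ∷ rs′) ≡.refl (ss , length≡ , sorted-ss , ss<0 , roots) =
        let q , deg-q , u≈ = factor-roots ss 2 u sorted-ss roots
              (≡.subst (λ n → DegreeAtMost n u) (≡.sym size) u-degree)
        in ss , q , u≈ , ss<0 , deg-q , conclude q u≈ deg-q
        where
        size : length ss ℕ.+ 2 ≡.≡ suc (suc (length rs′))
        size = ≡.trans (ℕ.+-comm (length ss) 2) (≡.cong (λ n → suc (suc n)) length≡)

        conclude : ∀ q → u ≈ₚ withRoots ss q → DegreeAtMost 2 q →
          coeff q 0 ≉ 0# × coeff q 0 * coeff q 2 ≤ 0#
        conclude q u≈ deg-q =
          (λ h → u-0≉0 (trans u-0-q (trans (*-congˡ h) (zeroʳ _)))) ,
          inj₁ (0<-⇒neg (*-pos-cancelʳ (inj₁ (∏-pos ss<0)) (<-respʳ-≈ (begin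
            (- (α * lead)) * (∏ rs 0# * (c * c))
              ≈⟨ solve 4 (λ a l p c → (:- (a :* l)) :* (p :* (c :* c)) := :- ((a :* (p :* c)) :* (l :* c)))
                   refl α lead (∏ rs 0#) c ⟩
            - (α * (∏ rs 0# * c) * (lead * c))
              ≈⟨ -‿cong (*-cong (trans (sym u-0) u-0-q) (trans (sym u-leading) leading)) ⟩
            - ((∏ ss 0# * coeff q 0) * coeff q 2)
              ≈⟨ solve 3 (λ p s t → :- ((p :* s) :* t) := (:- (s :* t)) :* p) refl (∏ ss 0#) _ _ ⟩
            (- (coeff q 0 * coeff q 2)) * ∏ ss 0# ∎)
            (*-pos (neg⇒0<- αlead<0) (*-pos (∏-pos rs<0) (square-pos c≉0))))))
          where
          u-0-q : eval u 0# ≈ ∏ ss 0# * coeff q 0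
          u-0-q = trans (eval-cong u (withRoots ss q) u≈ 0#) (trans (eval-withRoots ss q 0#) (*-congˡ (eval-0 q)))
          leading : coeff u (suc d) ≈ coeff q 2
          leading = ≡.subst (λ n → coeff u n ≈ coeff q 2) size
            (trans (u≈ _) (withRoots-leading ss deg-q))

  -- Polynomials with at most one positive zero

  quadratic : ∀ q → DegreeAtMost 2 q → q ≈ₚ coeff q 0 ∷ coeff q 1 ∷ coeff q 2 ∷ []
  quadratic q deg 0                   = refl
  quadratic q deg 1                   = refl
  quadratic q deg 2                   = refl
  quadratic q deg (suc (suc (suc n))) = deg (3 ℕ.+ n) (s≤s (s≤s (s≤s z≤n)))

  -- A factor X - r has no zero x + yi with y ≠ 0: multiplying the value of the
  -- product by the conjugate of x - r + yi gives a positive multiple of the value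
  -- A + Bi of the other factors.
  nonreal-zero : ∀ rs q {x y} → y ≉ 0# →
    evalRe (- 1#) x y (withRoots rs q) ≈ 0# × evalIm (- 1#) x y (withRoots rs q) ≈ 0# →
    evalRe (- 1#) x y q ≈ 0# × evalIm (- 1#) x y q ≈ 0#
  nonreal-zero []       q y≉0 zeros = zeros
  nonreal-zero (r ∷ rs) q {x} {y} y≉0 (Re≈0 , Im≈0) = nonreal-zero rs q y≉0
    ( *-≈0 N≉0 (begin
        N * A ≈⟨ solve 5 (λ x y r A B → ((x :- r) :* (x :- r) :+ y :* y) :* A
                   := (x :- r) :* (re* x y r A B) :+ y :* (im* x y r A B)) refl x y r A B ⟩
        (x - r) * _ + y * _   ≈⟨ +-cong (*-congˡ (trans (sym (proj₁ product)) Re≈0)) (*-congˡ (trans (sym (proj₂ product)) Im≈0)) ⟩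
        (x - r) * 0# + y * 0# ≈⟨ solve 2 (λ s t → s :* :0 :+ t :* :0 := :0) refl (x - r) y ⟩
        0# ∎)
    , *-≈0 N≉0 (begin
        N * B ≈⟨ solve 5 (λ x y r A B → ((x :- r) :* (x :- r) :+ y :* y) :* B
                   := (x :- r) :* (im* x y r A B) :- y :* (re* x y r A B)) refl x y r A B ⟩
        (x - r) * _ - y * _   ≈⟨ +-cong (*-congˡ (trans (sym (proj₂ product)) Im≈0)) (-‿cong (*-congˡ (trans (sym (proj₁ product)) Re≈0))) ⟩
        (x - r) * 0# - y * 0# ≈⟨ solve 2 (λ s t → s :* :0 :- t :* :0 := :0) refl (x - r) y ⟩
        0# ∎))
    where
    open import Relation.Binary.Reasoning.Setoid setoid
    p : Poly
    p = withRoots rs q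
    A B N : Carrier
    A = evalRe (- 1#) x y p
    B = evalIm (- 1#) x y p
    N = (x - r) * (x - r) + y * y
    N≉0 : N ≉ 0#
    N≉0 with square-nonneg (x - r)
    ... | inj₁ 0<  = pos⇒≉0 (+-pos 0< (square-pos y≉0))
    ... | inj₂ 0≈  = pos⇒≉0 (<-respʳ-≈ (trans (sym (+-identityˡ _)) (+-congʳ 0≈)) (square-pos y≉0))
    product : _
    product = quadEval-* (- 1#) x y (X- r) p
    -- The components of ((x - r) + yi) (A + Bi), in the form to which evaluation
    -- of X - r unfolds.
    re* im* : ∀ {n} (x y r A B : RingSolving.Polynomial n) → RingSolving.Polynomial n
    re* x y r A B = Re :* A :+ (:- :1) :* (Im :* B)
      where
      Re₁ Im₁ Re Im : _
      Im₁ = x :* :0 :+ y :* :0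
      Re₁ = :1 :+ (x :* :0 :+ (:- :1) :* (y :* :0))
      Re  = (:- r) :+ (x :* Re₁ :+ (:- :1) :* (y :* Im₁))
      Im  = x :* Im₁ :+ y :* Re₁
    im* x y r A B = Re :* B :+ Im :* A
      where
      Re₁ Im₁ Re Im : _
      Im₁ = x :* :0 :+ y :* :0
      Re₁ = :1 :+ (x :* :0 :+ (:- :1) :* (y :* :0))
      Re  = (:- r) :+ (x :* Re₁ :+ (:- :1) :* (y :* Im₁))
      Im  = x :* Im₁ :+ y :* Re₁

  zero-quadEval : ∀ p z → IsZeroOf p z →
    evalRe (- 1#) (re z) (im z) p ≈ 0# × evalIm (- 1#) (re z) (im z) p ≈ 0#
  zero-quadEval p z (re≈0 , im≈0) =
    trans (sym (proj₁ (evalᶜ≈quadEval p z))) re≈0 , trans (sym (proj₂ (evalᶜ≈quadEval p z))) im≈0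

  real-zero : ∀ p z → im z ≈ 0# → IsZeroOf p z → eval p (re z) ≈ 0#
  real-zero p z y≈0 zeroᶜ = trans
    (eval≈evalRe (- 1#) (re z) (im z) (trans (*-congˡ y≈0) (zeroʳ _)) p)
    (proj₁ (zero-quadEval p z zeroᶜ))

  nonneg-root : ∀ {rs q x} → 0# ≤ x → All (_< 0#) rs → eval (withRoots rs q) x ≈ 0# → eval q x ≈ 0#
  nonneg-root {rs} {q} {x} 0≤x rs<0 h = *-≈0 (pos⇒≉0 (∏-pos (All.map (λ r<0 → <-≤-trans r<0 0≤x) rs<0)))
    (trans (sym (eval-withRoots rs q x)) h)

  -- Here w stands for the product of two zeros of q₀ + q₁ X + q₂ X².
  no-nonneg-product : ∀ {q₀ q₂ w} → q₀ ≉ 0# → q₀ * q₂ ≤ 0# → 0# ≤ w → q₀ - w * q₂ ≉ 0#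
  no-nonneg-product {q₀} {q₂} {w} q₀≉0 q₀q₂≤0 0≤w h = ≤-<-irrefl (*-nonneg 0≤w (0≤- q₀q₂≤0))
    (0<-⇒neg (<-respʳ-≈ (begin
      q₀ * q₀                ≈⟨ *-congˡ (-‿≈0 h) ⟩
      q₀ * (w * q₂)          ≈⟨ solve 3 (λ s w t → s :* (w :* t) := :- (w :* (:- (s :* t)))) refl q₀ w q₂ ⟩
      - (w * - (q₀ * q₂))    ∎) (square-pos q₀≉0)))
    where
    open import Relation.Binary.Reasoning.Setoid setoid
    0≤- : ∀ {x} → x ≤ 0# → 0# ≤ - x
    0≤- (inj₁ x<0) = inj₁ (neg⇒0<- x<0)
    0≤- (inj₂ x≈0) = inj₂ (sym (trans (-‿cong x≈0) (solve 0 (:- :0 := :0) refl)))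

  -- Two distinct positive zeros r and s of q, a positive double zero r, and a
  -- zero x + yi with y ≠ 0 would satisfy q₀ = w q₂ with w = r s, r² and x² + y²
  -- respectively. The three computations below eliminate q₁.
  indefinite-zeros : ∀ w rs q → w ≈ₚ withRoots rs q → All (_< 0#) rs → DegreeAtMost 2 q →
    coeff q 0 ≉ 0# → coeff q 0 * coeff q 2 ≤ 0# → AllZerosReal w × AtMostOnePositiveZero w
  indefinite-zeros w rs q w≈ rs<0 deg q₀≉0 q₀q₂≤0 = all-real , at-most-one , simple
    where
    open import Relation.Binary.Reasoning.Setoid setoid
    q₀ q₁ q₂ : Carrier
    q₀ = coeff q 0
    q₁ = coeff q 1
    q₂ = coeff q 2
    Q : Poly
    Q = q₀ ∷ q₁ ∷ q₂ ∷ []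

    all-real : AllZerosReal w
    all-real z zeroᶜ with im z ≈? 0#
    ... | yes y≈0 = y≈0
    ... | no  y≉0 = ⊥-elim (no-nonneg-product q₀≉0 q₀q₂≤0 (sum-nonneg (square-nonneg x) (square-nonneg y))
        (*-≈0 y≉0 (begin
          y * (q₀ - (x * x + y * y) * q₂)
            ≈⟨ solve 5 (λ x y a b c →
                 y :* (a :- (x :* x :+ y :* y) :* c)
                   := y :* (a :+ (x :* (b :+ (x :* (c :+ (x :* :0 :+ (:- :1) :* (y :* :0)))
                                                :+ (:- :1) :* (y :* (x :* :0 :+ y :* :0))))
                                 :+ (:- :1) :* (y :* (x :* (x :* :0 :+ y :* :0) :+ y :* (c :+ (x :* :0 :+ (:- :1) :* (y :* :0)))))))
                      :- x :* (x :* (x :* (x :* :0 :+ y :* :0) :+ y :* (c :+ (x :* :0 :+ (:- :1) :* (y :* :0))))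
                               :+ y :* (b :+ (x :* (c :+ (x :* :0 :+ (:- :1) :* (y :* :0)))
                                                :+ (:- :1) :* (y :* (x :* :0 :+ y :* :0))))))
                 refl x y q₀ q₁ q₂ ⟩
          y * evalRe (- 1#) x y Q - x * evalIm (- 1#) x y Q
            ≈⟨ +-cong (*-congˡ (trans (sym (proj₁ q≈)) (proj₁ zeros))) (-‿cong (*-congˡ (trans (sym (proj₂ q≈)) (proj₂ zeros)))) ⟩
          y * 0# - x * 0#
            ≈⟨ solve 2 (λ s t → s :* :0 :- t :* :0 := :0) refl y x ⟩
          0# ∎)))
      where
      x y : Carrier
      x = re z
      y = im z
      sum-nonneg : ∀ {s t} → 0# ≤ s → 0# ≤ t → 0# ≤ s + t
      sum-nonneg (inj₁ 0<s) (inj₁ 0<t) = inj₁ (+-pos 0<s 0<t)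
      sum-nonneg {s} 0≤s (inj₂ 0≈t) with 0≤s
      ... | inj₁ 0<s = inj₁ (<-respʳ-≈ (trans (sym (+-identityʳ s)) (+-congˡ 0≈t)) 0<s)
      ... | inj₂ 0≈s = inj₂ (trans (sym (+-identityʳ 0#)) (+-cong 0≈s 0≈t))
      sum-nonneg {s} {t} (inj₂ 0≈s) (inj₁ 0<t) = inj₁ (<-respʳ-≈ (trans (sym (+-identityˡ t)) (+-congʳ 0≈s)) 0<t)
      w≈′ : _
      w≈′ = quadEval-cong (- 1#) x y w (withRoots rs q) w≈
      zeros : evalRe (- 1#) x y q ≈ 0# × evalIm (- 1#) x y q ≈ 0#
      zeros = nonreal-zero rs q y≉0
        ( trans (sym (proj₁ w≈′)) (proj₁ (zero-quadEval w z zeroᶜ))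
        , trans (sym (proj₂ w≈′)) (proj₂ (zero-quadEval w z zeroᶜ)))
      q≈ : evalRe (- 1#) x y q ≈ evalRe (- 1#) x y Q × evalIm (- 1#) x y q ≈ evalIm (- 1#) x y Q
      q≈ = quadEval-cong (- 1#) x y q Q (quadratic q deg)

    positive-zero : ∀ r → 0# < r → eval w r ≈ 0# → eval Q r ≈ 0#
    positive-zero r 0<r h = trans (sym (eval-cong q Q (quadratic q deg) r))
      (nonneg-root {rs} {q} (inj₁ 0<r) rs<0 (trans (sym (eval-cong w (withRoots rs q) w≈ r)) h))

    at-most-one : ∀ r s → 0# < r → 0# < s → IsZeroOf w (ofReal r) → IsZeroOf w (ofReal s) → r ≈ s
    at-most-one r s 0<r 0<s zero-r zero-s with r ≈? s
    ... | yes r≈s = r≈s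
    ... | no  r≉s = ⊥-elim (no-nonneg-product q₀≉0 q₀q₂≤0 (inj₁ (*-pos 0<r 0<s))
      (*-≈0 (λ h → r≉s (sym (-‿≈0 h))) (begin
        (s - r) * (q₀ - (r * s) * q₂)
          ≈⟨ solve 5 (λ r s a b c → (s :- r) :* (a :- (r :* s) :* c)
               := s :* (a :+ r :* (b :+ r :* (c :+ r :* :0))) :- r :* (a :+ s :* (b :+ s :* (c :+ s :* :0))))
               refl r s q₀ q₁ q₂ ⟩
        s * eval Q r - r * eval Q s
          ≈⟨ +-cong (*-congˡ (positive-zero r 0<r (real-zero w _ refl zero-r)))
                    (-‿cong (*-congˡ (positive-zero s 0<s (real-zero w _ refl zero-s)))) ⟩
        s * 0# - r * 0#
          ≈⟨ solve 2 (λ s t → s :* :0 :- t :* :0 := :0) refl s r ⟩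
        0# ∎)))

    simple : ∀ r → 0# < r → ¬ ((X- r) *ₚ (X- r) ∣ₚ w)
    simple r 0<r (g , w≈g) = no-nonneg-product q₀≉0 q₀q₂≤0 (inj₁ (*-pos 0<r 0<r)) (begin
      q₀ - (r * r) * q₂
        ≈⟨ solve 4 (λ r a b c → a :- (r :* r) :* c
             := (a :+ r :* (b :+ r :* (c :+ r :* :0))) :- r :* ((b :+ r :* (c :+ r :* :0)) :+ r :* (c :+ r :* :0 :+ r :* (:0 :+ r :* :0)))) refl r q₀ q₁ q₂ ⟩
      eval Q r - r * (eval (q₁ ∷ q₂ ∷ []) r + r * (eval (q₂ ∷ []) r + r * (0# + r * 0#)))
        ≈⟨ +-congˡ (-‿cong (*-congˡ D≈)) ⟨
      eval Q r - r * evalD Q r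
        ≈⟨ +-cong (positive-zero r 0<r w-root) (-‿cong (*-congˡ (trans (sym (evalD-cong q Q (quadratic q deg) r)) D-root))) ⟩
      0# - r * 0#
        ≈⟨ solve 1 (λ r → :0 :- r :* :0 := :0) refl r ⟩
      0# ∎)
      where
      D≈ : evalD Q r ≈ eval (q₁ ∷ q₂ ∷ []) r + r * (eval (q₂ ∷ []) r + r * (0# + r * 0#))
      D≈ = trans (evalD-∷ q₀ (q₁ ∷ q₂ ∷ []) r) (+-congˡ (*-congˡ
        (trans (evalD-∷ q₁ (q₂ ∷ []) r) (+-congˡ (*-congˡ (evalD-∷ q₂ [] r))))))
      S : Poly
      S = (X- r) *ₚ (X- r)
      r-r : eval (X- r) r ≈ 0#
      r-r = trans (eval-X- r r) (-‿inverseʳ r)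
      S-root : eval S r ≈ 0#
      S-root = trans (eval-* (X- r) (X- r) r) (trans (*-congʳ r-r) (zeroˡ _))
      S-D-root : evalD S r ≈ 0#
      S-D-root = trans (evalD-* (X- r) (X- r) r) (trans (+-cong (*-congʳ r-r) (*-congˡ r-r))
        (solve 1 (λ d → :0 :* d :+ d :* :0 := :0) refl _))
      w-root : eval w r ≈ 0#
      w-root = trans (eval-cong w (S *ₚ g) w≈g r)
        (trans (eval-* S g r) (trans (*-congʳ S-root) (zeroˡ _)))
      w-D-root : evalD w r ≈ 0#
      w-D-root = trans (evalD-cong w (S *ₚ g) w≈g r)
        (trans (evalD-* S g r) (trans (+-cong (*-congʳ S-root) (*-congʳ S-D-root))
          (solve 2 (λ s t → :0 :* s :+ :0 :* t := :0) refl _ _)))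
      q-root : eval q r ≈ 0#
      q-root = nonneg-root {rs} {q} (inj₁ 0<r) rs<0 (trans (sym (eval-cong w (withRoots rs q) w≈ r)) w-root)
      D-root : evalD q r ≈ 0#
      D-root = *-≈0 (pos⇒≉0 (∏-pos (All.map (λ s<0 → <-trans s<0 0<r) rs<0))) (begin
        ∏ rs r * evalD q r                          ≈⟨ +-identityˡ _ ⟨
        0# + ∏ rs r * evalD q r                     ≈⟨ +-congʳ (trans (*-congˡ q-root) (zeroʳ _)) ⟨
        ∏′ rs r * eval q r + ∏ rs r * evalD q r     ≈⟨ evalD-withRoots rs q r ⟨
        evalD (withRoots rs q) r                    ≈⟨ evalD-cong w (withRoots rs q) w≈ r ⟨
        evalD w r                                   ≈⟨ w-D-root ⟩
        0#                                          ∎)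

  leading≉0 : ∀ w rs c → w ≈ₚ withRoots rs (c ∷ []) → coeff w 0 ≉ 0# → c ≉ 0#
  leading≉0 w rs c w≈ w₀≉0 c≈0 = w₀≉0 (begin
    coeff w 0                       ≈⟨ eval-0 w ⟨
    eval w 0#                       ≈⟨ eval-cong w (withRoots rs (c ∷ [])) w≈ 0# ⟩
    eval (withRoots rs (c ∷ [])) 0# ≈⟨ eval-withRoots rs (c ∷ []) 0# ⟩
    ∏ rs 0# * eval (c ∷ []) 0#      ≈⟨ *-congˡ (trans (eval-const c 0#) c≈0) ⟩
    ∏ rs 0# * 0#                    ≈⟨ zeroʳ _ ⟩
    0#                              ∎)
    where open import Relation.Binary.Reasoning.Setoid setoid

  negativeZeros⇒indefinite : ∀ {d} w → NegativeZeros d w → coeff w 0 ≉ 0# →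
    AllZerosReal w × AtMostOnePositiveZero w
  negativeZeros⇒indefinite w (rs , _ , _ , rs<0 , c , w≈) w₀≉0 =
    indefinite-zeros w rs (c ∷ []) w≈ rs<0 (λ { (suc n) _ → refl }) (leading≉0 w rs c w≈ w₀≉0)
      (inj₂ (zeroʳ c))

  negativeZeros⇒allNegative : ∀ {d} w → NegativeZeros d w → coeff w 0 ≉ 0# → AllZerosRealNegative w
  negativeZeros⇒allNegative w zeros@(rs , _ , _ , rs<0 , c , w≈) w₀≉0 z zeroᶜ = y≈0 , x<0
    where
    y≈0 : im z ≈ 0#
    y≈0 = proj₁ (negativeZeros⇒indefinite w zeros w₀≉0) z zeroᶜ
    x<0 : re z < 0#
    x<0 with re z <? 0#
    ... | yes x<0 = x<0
    ... | no  x≮0 = ⊥-elim (leading≉0 w rs c w≈ w₀≉0 (trans (sym (eval-const c (re z)))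
      (nonneg-root {rs} {c ∷ []} (≮⇒≥ x≮0) rs<0
        (trans (sym (eval-cong w (withRoots rs (c ∷ [])) w≈ (re z))) (real-zero w z y≈0 zeroᶜ)))))

  -- Induction over the zeros of F

  -- A point a + k below the last but one zero is among the zeros, and it cannot be
  -- the last zero, which is at least as large as the last but one.
  init-condition : ∀ a p (α : Fin (suc p) → Carrier) →
    Condition a (suc p) α → Condition a p (λ i → α (inject₁ i))
  init-condition a zero    α _ = _
  init-condition a (suc p) α (0≤α , mono , covered) =
    0≤α ,
    (λ i j i≤j → mono (inject₁ i) (inject₁ j)
      (≡.subst₂ ℕ._≤_ (≡.sym (Fin.toℕ-inject₁ i)) (≡.sym (Fin.toℕ-inject₁ j)) i≤j)) ,
    λ k <α → let i , a+k≈αi = covered k (<-≤-trans <α (mono _ _ (Fin.≤fromℕ _)))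
             in not-last k <α i a+k≈αi
    where
    not-last : ∀ k → a + fromNat k < α (inject₁ (fromℕ p)) → ∀ i → a + fromNat k ≈ α i →
      ∃[ j ] a + fromNat k ≈ α (inject₁ j)
    not-last k <α i a+k≈αi with view i
    ... | ‵inject₁ j = j , a+k≈αi
    ... | ‵fromℕ     = ⊥-elim (≤-<-irrefl (mono (inject₁ (fromℕ p)) (fromℕ (suc p)) (Fin.≤fromℕ _))
                         (<-respˡ-≈ a+k≈αi <α))

  -- For some d, the Eulerian polynomial belonging to the p zeros α is a constant
  -- multiple of a product of d distinct factors X - r with r < 0, and the zeros α
  -- are all less than a + k, where k = p - d.
  Invariant : (a e : Carrier) → ∀ p → (Fin p → Carrier) → Set
  Invariant a e p α = ∃[ d ] ∃[ k ] d ℕ.+ k ≡.≡ p × NegativeZeros d (eulerian a e p α) ×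
                      (∀ i → α i < a + fromNat k)

  -- With b = p + a, this factor decides by how much the degree of the Eulerian
  -- polynomial grows when the zero α is added.
  lead-identity : ∀ a d {k p} α → d ℕ.+ k ≡.≡ p →
    (fromNat p + a) - α - fromNat d ≈ (a + fromNat k) - α
  lead-identity a d {k} α ≡.refl = trans (+-congʳ (+-congʳ (+-congʳ (fromNat-+ d k))))
    (solve 4 (λ d k a α → ((d :+ k) :+ a) :- α :- d := (a :+ k) :- α) refl (fromNat d) (fromNat k) a α)

  +-fromNat-pos : ∀ {a} → 0# < a → ∀ k → 0# < a + fromNat k
  +-fromNat-pos {a} 0<a zero    = <-respʳ-≈ (sym (+-identityʳ a)) 0<a
  +-fromNat-pos     0<a (suc k) = +-pos 0<a (fromNat-suc-pos k)

  eulerian-0-suc : ∀ a e p α → coeff (eulerian a e (suc p) α) 0 ≉ 0# →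
    α (fromℕ p) ≉ 0# × coeff (eulerian a e p (λ i → α (inject₁ i))) 0 ≉ 0#
  eulerian-0-suc a e p α h = *-≉0⇒ˡ product , *-≉0⇒ʳ product
    where
    product : α (fromℕ p) * coeff (eulerian a e p (λ i → α (inject₁ i))) 0 ≉ 0#
    product eq = h (trans (addZero-coeff-zero _ _ (eulerian a e p (λ i → α (inject₁ i)))) eq)

  last-cases : ∀ {p} {α : Fin (suc p) → Carrier} {x} →
    (∀ i → α (inject₁ i) < x) → α (fromℕ p) < x → ∀ i → α i < x
  last-cases init last i with view i
  ... | ‵inject₁ j = init j
  ... | ‵fromℕ     = last

  module _ (a e : Carrier) where

    invariant-step : ∀ p (α : Fin (suc p) → Carrier) →
      coeff (eulerian a e p (λ i → α (inject₁ i))) 0 ≉ 0# → 0# < α (fromℕ p) →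
      (inv : Invariant a e p (λ i → α (inject₁ i))) → α (fromℕ p) ≤ a + fromNat (proj₁ (proj₂ inv)) →
      Invariant a e (suc p) α
    invariant-step p α v₀≉0 0<α (d , k , d+k≡p , (rs , ≡.refl , sorted , rs<0 , c , v≈) , α<) = by-cases
      where
      v : Poly
      v = eulerian a e p (λ i → α (inject₁ i))
      module S = Step rs sorted rs<0 c v v≈ (leading≉0 v rs c v≈ v₀≉0) (α (fromℕ p)) (fromNat p + a)
      lead≈ : S.lead ≈ (a + fromNat k) - α (fromℕ p)
      lead≈ = lead-identity a (length rs) (α (fromℕ p)) d+k≡p
      by-cases : α (fromℕ p) ≤ a + fromNat k → Invariant a e (suc p) α
      by-cases (inj₁ α<a+k) = suc d , k , ≡.cong suc d+k≡p ,
        S.regular-step 0<α (<-respʳ-≈ (sym lead≈) (<⇒0<- α<a+k)) , last-cases {α = α} α< α<a+k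
      by-cases (inj₂ α≈a+k) = d , suc k , ≡.trans (ℕ.+-suc d k) (≡.cong suc d+k≡p) ,
        S.degenerate-step 0<α (trans lead≈ (trans (+-congˡ (-‿cong α≈a+k)) (-‿inverseʳ _))) ,
        last-cases {α = α} (λ i → <-trans (α< i) a+k<) (<-respˡ-≈ (sym α≈a+k) a+k<)
        where
        a+k< : a + fromNat k < a + fromNat (suc k)
        a+k< = 0<-⇒< (<-respʳ-≈ (solve 2 (λ a k → :1 := (a :+ (:1 :+ k)) :- (a :+ k)) refl a (fromNat k)) 0<1)

    invariant : ∀ p (α : Fin p → Carrier) → Condition a p α →
      coeff (eulerian a e p α) 0 ≉ 0# → Invariant a e p α
    invariant zero    α _ _ =
      0 , 0 , ≡.refl , ([] , ≡.refl , [] , [] , e , λ _ → refl) , λ ()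
    invariant (suc p) α condition@(0≤α , mono , covered) u₀≉0 =
      invariant-step p α v₀≉0 0<α inv (≮⇒≥ uncovered)
      where
      α≉0 : α (fromℕ p) ≉ 0#
      α≉0 = proj₁ (eulerian-0-suc a e p α u₀≉0)
      v₀≉0 : coeff (eulerian a e p (λ i → α (inject₁ i))) 0 ≉ 0#
      v₀≉0 = proj₂ (eulerian-0-suc a e p α u₀≉0)
      0<α : 0# < α (fromℕ p)
      0<α = ≤-≉⇒< (≤-trans 0≤α (mono Fin.zero (fromℕ p) z≤n)) (λ 0≈α → α≉0 (sym 0≈α))
      inv : Invariant a e p (λ i → α (inject₁ i))
      inv = invariant p (λ i → α (inject₁ i)) (init-condition a p α condition) v₀≉0
      k : ℕ
      k = proj₁ (proj₂ inv)
      α< : ∀ i → α (inject₁ i) < a + fromNat k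
      α< = proj₂ (proj₂ (proj₂ (proj₂ inv)))
      uncovered : ¬ (a + fromNat k < α (fromℕ p))
      uncovered a+k<α with covered k a+k<α
      ... | i , a+k≈αi with view i
      ...   | ‵inject₁ j = irrefl (sym a+k≈αi) (α< j)
      ...   | ‵fromℕ     = irrefl a+k≈αi a+k<α

    -- The condition on the zeros says nothing about the last one here.
    last-zero : ∀ p (α : Fin (suc p) → Carrier) → 0# < a →
      coeff (eulerian a e (suc p) α) 0 ≉ 0# → Invariant a e p (λ i → α (inject₁ i)) →
      AllZerosReal (eulerian a e (suc p) α) × AtMostOnePositiveZero (eulerian a e (suc p) α)
    last-zero p α 0<a u₀≉0 inv@(d , k , d+k≡p , (rs , ≡.refl , sorted , rs<0 , c , v≈) , _) =
      by-cases (compare 0# αₚ) (compare αₚ (a + fromNat k))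
      where
      αₚ : Carrier
      αₚ = α (fromℕ p)
      u v : Poly
      u = eulerian a e (suc p) α
      v = eulerian a e p (λ i → α (inject₁ i))
      αₚ≉0 : αₚ ≉ 0#
      αₚ≉0 = proj₁ (eulerian-0-suc a e p α u₀≉0)
      v₀≉0 : coeff v 0 ≉ 0#
      v₀≉0 = proj₂ (eulerian-0-suc a e p α u₀≉0)
      module S = Step rs sorted rs<0 c v v≈ (leading≉0 v rs c v≈ v₀≉0) αₚ (fromNat p + a)
      lead≈ : S.lead ≈ (a + fromNat k) - αₚ
      lead≈ = lead-identity a (length rs) αₚ d+k≡p
      0<a+k : 0# < a + fromNat k
      0<a+k = +-fromNat-pos 0<a k

      Claim : Set
      Claim = AllZerosReal u × AtMostOnePositiveZero u
      admissible : 0# < αₚ → αₚ ≤ a + fromNat k → Claim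
      admissible 0<αₚ αₚ≤a+k =
        let _ , _ , _ , zeros , _ = invariant-step p α v₀≉0 0<αₚ inv αₚ≤a+k
        in negativeZeros⇒indefinite u zeros u₀≉0
      inadmissible : αₚ * ((a + fromNat k) - αₚ) < 0# → Claim
      inadmissible h =
        let ss , q , u≈ , ss<0 , deg , q₀≉0 , q₀q₂≤0 = S.indefinite-step (<-respˡ-≈ (*-congˡ (sym lead≈)) h)
        in indefinite-zeros u ss q u≈ ss<0 deg q₀≉0 q₀q₂≤0

      by-cases : Tri (0# < αₚ) (0# ≈ αₚ) (αₚ < 0#) →
        Tri (αₚ < a + fromNat k) (αₚ ≈ a + fromNat k) (a + fromNat k < αₚ) → Claim
      by-cases (tri≈ _ 0≈α _)  _                = ⊥-elim (αₚ≉0 (sym 0≈α))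
      by-cases (tri> _ _ α<0)  _                = inadmissible
        (<-respˡ-≈ (*-comm _ _) (pos*neg (<⇒0<- (<-trans α<0 0<a+k)) α<0))
      by-cases (tri< 0<α _ _) (tri< α<a+k _ _)  = admissible 0<α (inj₁ α<a+k)
      by-cases (tri< 0<α _ _) (tri≈ _ α≈a+k _)  = admissible 0<α (inj₂ α≈a+k)
      by-cases (tri< 0<α _ _) (tri> _ _ a+k<α)  = inadmissible
        (pos*neg 0<α (0<-⇒neg (<-respʳ-≈
          (solve 2 (λ x y → x :- y := :- (y :- x)) refl αₚ (a + fromNat k)) (<⇒0<- a+k<α))))

  -- Zeros of equal polynomials

  zero-cong : ∀ {w u} → w ≈ₚ u → ∀ z → IsZeroOf w z → IsZeroOf u z
  zero-cong {w} {u} w≈u z zeroᶜ =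
    let Re≈ , Im≈ = quadEval-cong (- 1#) (re z) (im z) w u w≈u
        Re≈0 , Im≈0 = zero-quadEval w z zeroᶜ
        re≈ , im≈ = evalᶜ≈quadEval u z
    in trans re≈ (trans (sym Re≈) Re≈0) , trans im≈ (trans (sym Im≈) Im≈0)

  allZerosRealNegative-cong : ∀ {w u} → w ≈ₚ u → AllZerosRealNegative u → AllZerosRealNegative w
  allZerosRealNegative-cong {w} {u} w≈u negative z zeroᶜ = negative z (zero-cong {w} {u} w≈u z zeroᶜ)

  atMostOnePositive-cong : ∀ {w u} → w ≈ₚ u →
    AllZerosReal u × AtMostOnePositiveZero u → AllZerosReal w × AtMostOnePositiveZero w
  atMostOnePositive-cong {w} {u} w≈u (real , unique , simple) =
    (λ z zeroᶜ → real z (zero-cong {w} {u} w≈u z zeroᶜ)) ,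
    (λ r s 0<r 0<s zero-r zero-s →
      unique r s 0<r 0<s (zero-cong {w} {u} w≈u _ zero-r) (zero-cong {w} {u} w≈u _ zero-s)) ,
    λ r 0<r (g , w≈g) → simple r 0<r (g , λ n → trans (sym (w≈u n)) (w≈g n))

  eulerian-constant-term : ∀ {a m} F w → eval F 0# ≈ 1# → IsEulerianPolynomial a m F w → coeff w 0 ≉ 0#
  eulerian-constant-term {a} {m} F w F0≈1 (_ , series) w₀≈0 =
    *-≉0 {eval F 0#} (λ h → pos⇒≉0 0<1 (trans (sym F0≈1) h)) (binomialSeries-0 a)
      (trans (series 0) (trans (+-congʳ (trans (*-congʳ w₀≈0) (zeroˡ _))) (+-identityʳ 0#)))

theorem1 :
    (ℝ : CompleteOrderedField) →
    let open CompleteOrderedField ℝ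
        open Eulerian ℝ
    in
    (n : ℕ) → let m = suc n in
    (a : Carrier) → 0# < a →
    (F : Poly) → HasDegree m F → eval F 0# ≈ 1# →
    (α : Fin m → Carrier) → ZerosWithMultiplicity (reflect F) α →
    (w : Poly) → IsEulerianPolynomial a m F w →
    (Condition a m α → AllZerosRealNegative w) ×
    (Condition a n (λ i → α (inject₁ i)) →
      AllZerosReal w × AtMostOnePositiveZero w)
theorem1 ℝ n a 0<a F _ F0≈1 α zeros w eulerian-w = negative , at-most-one
  where
  open CompleteOrderedField ℝ
  open Eulerian ℝ
  open EulerianZeros ℝ
  e : Carrier
  e = proj₁ (eval-from-zeros F α zeros)
  u : Poly
  u = eulerian a e (suc n) α
  w≈u : w ≈ₚ u
  w≈u = eulerian-unique F α w e (proj₂ (eval-from-zeros F α zeros)) eulerian-w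
  u₀≉0 : coeff u 0 ≉ 0#
  u₀≉0 h = eulerian-constant-term F w F0≈1 eulerian-w (trans (w≈u 0) h)

  negative : Condition a (suc n) α → AllZerosRealNegative w
  negative condition =
    let _ , _ , _ , zeros , _ = invariant a e (suc n) α condition u₀≉0
    in allZerosRealNegative-cong {w} {u} w≈u (negativeZeros⇒allNegative u zeros u₀≉0)

  at-most-one : Condition a n (λ i → α (inject₁ i)) → AllZerosReal w × AtMostOnePositiveZero w
  at-most-one condition = atMostOnePositive-cong {w} {u} w≈u
    (last-zero a e n α 0<a u₀≉0 (invariant a e n (λ i → α (inject₁ i)) condition
      (proj₂ (eulerian-0-suc a e n α u₀≉0))))
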